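{- Let $n\ge 0$ and $0\le k\le n$. Then $B_{n,k}$ equals each of the following: (1) the number of matchings on $2(n+1)$ points that avoid both patterns $123$ and $213$ and have exactly $k$ nestings; (2) the number of matchings on $2(n+1)$ points that avoid both patterns $231$ and $321$ and have exactly $k$ crossings.
   Context: A matching on $\{1,\dots,2m\}$ is a partition into $m$ pairs (arcs) $(i,j)$ with $i<j$. Two arcs $(i,j),(k,\ell)$ form a crossing if $i<k<j<\ell$ and a nesting if $i<k<\ell<j$; the number of crossings (nestings) of a matching is the number of unordered pairs of arcs forming a crossing (nesting). A matching $M$ avoids a pattern $\sigma\in\mathfrak S_r$ if there are no $2r$ points $i_1<i_2<\cdots<i_{2r}$ such that $M$ contains all the pairs $(i_s,i_{2r+1-\sigma(s)})$ for $1\le s\le r$. Catalan's triangle: $C_{n,s}=\frac{n-s+1}{n+1}\binom{n+s}{n}$; Borel's triangle: $B_{n,k}=\sum_{s=k}^{n}\binom{s}{k}C_{n,s}$. -}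

module Defs where

open import Data.Nat using (ℕ; zero; suc; _+_; _*_; _∸_; _/_; _≡ᵇ_; _<ᵇ_)
open import Data.Nat.Combinatorics using (_C_)
open import Data.Bool using (Bool; true; false; _∧_; _∨_; if_then_else_)
open import Data.Fin using (Fin; toℕ; _↑ˡ_) renaming (zero to f0; suc to fs)
open import Data.List using (List; []; _∷_; map; concatMap; applyUpTo; allFin)
open import Data.Nat.ListAction using (sum)
open import Data.Vec using (Vec; []; _∷_; lookup)

-- Catalan's triangle  C_{n,s} = (n-s+1)/(n+1) * binom(n+s, n)   (exact division)
catalanT : ℕ → ℕ → ℕ
catalanT n s = ((suc n ∸ s) * ((n + s) C n)) / suc n

borelT : ℕ → ℕ → ℕ
borelT n k = sum (map (λ s → (s C k) * catalanT n s) (applyUpTo (k +_) (suc n ∸ k)))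

allVec : (n m : ℕ) → List (Vec (Fin m) n)
allVec zero    m = [] ∷ []
allVec (suc n) m = concatMap (λ x → map (x ∷_) (allVec n m)) (allFin m)

countB : {A : Set} → (A → Bool) → List A → ℕ
countB p []       = 0
countB p (x ∷ xs) = (if p x then 1 else 0) + countB p xs

anyB : {A : Set} → (A → Bool) → List A → Bool
anyB p []       = false
anyB p (x ∷ xs) = p x ∨ anyB p xs

allB : {A : Set} → (A → Bool) → List A → Bool
allB p []       = true
allB p (x ∷ xs) = p x ∧ allB p xs

_=ᶠ_ : {m : ℕ} → Fin m → Fin m → Bool
i =ᶠ j = toℕ i ≡ᵇ toℕ j

_<ᶠ_ : {m : ℕ} → Fin m → Fin m → Bool
i <ᶠ j = toℕ i <ᵇ toℕ j

-- Matchings on N points (points 0..N-1, i.e. the paper's 1..N shifted)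
-- A candidate is a "partner vector" v : v[i] is the point matched to i.
-- It is a matching iff v is a fixed-point-free involution.

isMatching : {N : ℕ} → Vec (Fin N) N → Bool
isMatching {N} v =
  allB (λ i → (lookup v (lookup v i) =ᶠ i) ∧ (if lookup v i =ᶠ i then false else true))
       (allFin N)

-- arcs (i,j) with i<j : i is an opener with partner j = v[i]
-- crossing: arcs (a, v a), (b, v b) with a < b < v a < v b
-- (each unordered pair counted once, ordered by left endpoint)
crossings : {N : ℕ} → Vec (Fin N) N → ℕ
crossings {N} v =
  sum (map (λ a → countB (λ b → (a <ᶠ b) ∧ (b <ᶠ lookup v a) ∧ (lookup v a <ᶠ lookup v b))
                         (allFin N))
           (allFin N))

nestings : {N : ℕ} → Vec (Fin N) N → ℕ
nestings {N} v =
  sum (map (λ a → countB (λ b → (a <ᶠ b) ∧ (b <ᶠ lookup v b) ∧ (lookup v b <ᶠ lookup v a))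
                         (allFin N))
           (allFin N))

increasing : {N r : ℕ} → Vec (Fin N) r → Bool
increasing []           = true
increasing (x ∷ [])     = true
increasing (x ∷ y ∷ xs) = (x <ᶠ y) ∧ increasing (y ∷ xs)

-- A pattern σ ∈ S_r is given 0-indexed as the vector (σ(1)-1, …, σ(r)-1).
-- Index 2r+1-σ(s) (1-indexed) becomes  2r-1-(σ(s)-1)  (0-indexed).
reflectIx : (r : ℕ) → Fin r → ℕ
reflectIx r j = (r + r) ∸ suc (toℕ j)

containsPat : {N r : ℕ} → Vec (Fin r) r → Vec (Fin N) N → Bool
containsPat {N} {r} σ v =
  anyB (λ w → increasing w ∧
              allB (λ s → toℕ (lookup v (lookup w (s ↑ˡ r)))
                            ≡ᵇ lookupℕ w (reflectIx r (lookup σ s)))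
                   (allFin r))
       (allVec (r + r) N)
  where
  lookupℕ : {n : ℕ} → Vec (Fin N) n → ℕ → ℕ
  lookupℕ []       _       = N   -- out of range: never equals a point
  lookupℕ (x ∷ xs) zero    = toℕ x
  lookupℕ (x ∷ xs) (suc i) = lookupℕ xs i

avoids : {N r : ℕ} → Vec (Fin r) r → Vec (Fin N) N → Bool
avoids σ v = if containsPat σ v then false else true

p123 p213 p231 p321 : Vec (Fin 3) 3
p123 = f0 ∷ fs f0 ∷ fs (fs f0) ∷ []
p213 = fs f0 ∷ f0 ∷ fs (fs f0) ∷ []
p231 = fs f0 ∷ fs (fs f0) ∷ f0 ∷ []
p321 = fs (fs f0) ∷ fs f0 ∷ f0 ∷ []

countMatchings : (N : ℕ) → (Vec (Fin N) N → Bool) → ℕ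
countMatchings N p = countB (λ v → isMatching v ∧ p v) (allVec N N)

{-# OPTIONS --safe #-}

-- Call an arc (b, b′) covered by an arc (a, a′) with a < b if the two arcs are
-- nested (part 1) or crossing (part 2).  Avoiding the two patterns means that
-- every arc is covered at most once, so the statistic counts covered arcs.
-- Let p be the last opener of a matching.  All points after p are closers, so the
-- arc of p covers nothing, and the number of arcs covering it is determined by the
-- rank of its partner among these closers.  Hence there is one admissible partner
-- if p is followed by one closer and there are two, adding 0 and 1 to the
-- statistic, if it is followed by more; deleting the arc of p leaves an arbitrary
-- admissible matching.  Read from right to left, the matchings are thus Dyck paths
-- in which k of the down steps from height at least 2 are marked.  There are
-- C_{n,s} Dyck paths of semilength n + 1 with s such steps, and binom(s, k) ways
-- to mark them.
module Submission where

open import Defs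
open import Data.Nat using (ℕ; suc; _+_; _*_; _≤_)
open import Data.Bool using (_∧_)
open import Data.Product using (_×_)
open import Relation.Binary.PropositionalEquality using (_≡_)
open import Data.Nat using (_≡ᵇ_)

open import Data.Bool using (Bool; true; false; if_then_else_; T)
open import Data.Bool.Properties using (T-∧; T-∨; T?)
open import Data.Empty using (⊥-elim)
open import Data.Fin using (Fin; zero; suc; toℕ; fromℕ<; punchIn; punchOut)
open import Data.Fin.Permutation using (permutation)
open import Data.Fin.Properties using (punchIn-injective; punchInᵢ≢i; punchIn-punchOut; toℕ-injective; toℕ<n; toℕ-fromℕ<)
import Data.Fin.Properties as Fin
open import Data.List using (List; []; _∷_; _++_; map; length; filter; allFin; tabulate; applyUpTo; concatMap; cartesianProductWith)
open import Data.List.Membership.Propositional using (_∈_)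
open import Data.List.Membership.Propositional.Properties using (∈-map⁺; ∈-map⁻; ∈-filter⁺; ∈-filter⁻; ∈-++⁺ˡ; ∈-++⁺ʳ; ∈-++⁻; ∈-allFin; ∈-cartesianProductWith⁺)
open import Data.List.Membership.Propositional.Properties.WithK using (unique∧set⇒bag)
open import Data.List.Properties using (length-map; length-++; map-tabulate; map-applyUpTo)
open import Data.List.Relation.Binary.BagAndSetEquality using (∼bag⇒↭)
open import Data.List.Relation.Binary.Permutation.Propositional.Properties using (↭-length)
open import Data.List.Relation.Unary.All using ([])
open import Data.List.Relation.Unary.AllPairs using ([]; _∷_)
open import Data.List.Relation.Unary.Any using (here; there)
open import Data.List.Relation.Unary.Unique.Propositional using (Unique)
import Data.List.Relation.Unary.Unique.Propositional.Properties as Unique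
open import Data.Nat using (zero; _∸_; _/_; _<_; _>_; _<ᵇ_; z≤n; s≤s; z<s; s<s)
open import Data.Nat.Combinatorics using (_C_; nCk≡nC[n∸k]; nCk+nC[k+1]≡[n+1]C[k+1]; k>n⇒nCk≡0; nCn≡1; nC1≡n)
open import Data.Nat.DivMod using (m*n/n≡m; /-congˡ)
open import Data.Nat.ListAction using (sum)
open import Data.Nat.Properties
open import Data.Nat.Tactic.RingSolver using (solve-∀)
open import Data.Product using (Σ; ∃; _,_; proj₁; proj₂)
open import Data.Sum using (_⊎_; inj₁; inj₂; [_,_]′)
open import Data.Unit using (tt)
open import Data.Vec using (Vec; []; _∷_; lookup; insertAt) renaming (map to mapᵥ; tabulate to tabulateᵥ)
open import Data.Vec.Properties using (insertAt-lookup; insertAt-punchIn; lookup-map; lookup∘tabulate; tabulate∘lookup; tabulate-cong; ∷-injective)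
open import Function using (_∘_; id)
open import Function.Bundles using (mk⇔; Equivalence)
open import Relation.Binary using (Tri; tri<; tri≈; tri>)
open import Relation.Binary.PropositionalEquality using (_≢_; refl; sym; trans; cong; cong₂; subst; subst₂; module ≡-Reasoning)
open import Relation.Nullary using (¬_; yes; no; contradiction)

open import Algebra.Properties.CommutativeMonoid.Sum +-0-commutativeMonoid using (∑-comm; sum-remove; sum-permute; sum-cong-≗) renaming (sum to ∑)

open Equivalence using (to; from)
open ≡-Reasoning

-- First-passage counts and Catalan's triangle.

-- Lattice paths from height h with j up steps that reach height 0 only at their end.
firstPassages : ℕ → ℕ → ℕ
firstPassages zero    h       = 1
firstPassages (suc j) zero    = 0
firstPassages (suc j) (suc h) = firstPassages j (suc (suc h)) + firstPassages (suc j) h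

absorption : ∀ n k → suc k * (suc n C suc k) ≡ suc n * (n C k)
absorption n zero = begin
  1 * (suc n C 1)   ≡⟨ *-identityˡ _ ⟩
  suc n C 1         ≡⟨ nC1≡n (suc n) ⟩
  suc n             ≡⟨ *-identityʳ (suc n) ⟨
  suc n * 1         ∎
absorption zero (suc k) = *-zeroʳ (suc (suc k))
absorption (suc n) (suc k) = begin
  suc (suc k) * (suc (suc n) C suc (suc k))
    ≡⟨ cong (suc (suc k) *_) (sym (nCk+nC[k+1]≡[n+1]C[k+1] (suc n) (suc k))) ⟩
  suc (suc k) * (A + (suc n C suc (suc k)))
    ≡⟨ *-distribˡ-+ (suc (suc k)) A _ ⟩
  (A + suc k * A) + suc (suc k) * (suc n C suc (suc k))
    ≡⟨ cong₂ (λ x y → A + x + y) (absorption n k) (absorption n (suc k)) ⟩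
  A + suc n * (n C k) + suc n * (n C suc k)
    ≡⟨ +-assoc A _ _ ⟩
  A + (suc n * (n C k) + suc n * (n C suc k))
    ≡⟨ cong (A +_) (sym (*-distribˡ-+ (suc n) (n C k) _)) ⟩
  A + suc n * ((n C k) + (n C suc k))
    ≡⟨ cong (λ x → A + suc n * x) (nCk+nC[k+1]≡[n+1]C[k+1] n k) ⟩
  suc (suc n) * A ∎
  where
  A = suc n C suc k

C-next : ∀ k m → suc k * ((k + m) C suc k) ≡ m * ((k + m) C k)
C-next k m = +-cancelˡ-≡ (suc k * X) _ _ (begin
  suc k * X + suc k * Y    ≡⟨ *-distribˡ-+ (suc k) X Y ⟨
  suc k * (X + Y)          ≡⟨ cong (suc k *_) (nCk+nC[k+1]≡[n+1]C[k+1] (k + m) k) ⟩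
  suc k * (suc (k + m) C suc k) ≡⟨ absorption (k + m) k ⟩
  suc (k + m) * X          ≡⟨ *-distribʳ-+ X (suc k) m ⟩
  suc k * X + m * X        ∎)
  where
  X = (k + m) C k
  Y = (k + m) C suc k

C-sym : ∀ a b → (a + b) C a ≡ (a + b) C b
C-sym a b = trans (nCk≡nC[n∸k] (m≤m+n a b)) (cong ((a + b) C_) (m+n∸m≡n a b))

-- Without its final down step a first passage is a path from `h` to 1 with `suc j` up steps; by the
-- reflection principle the paths to 1 that touch 0 are counted by the binomial coefficient on the
-- left. Stated as a sum it avoids subtraction, and the proof follows Pascal's rule along the
-- recurrence of `firstPassages`.
reflection : ∀ j h →
  firstPassages (suc j) h + ((j + suc (j + h)) C j) ≡ (j + suc (j + h)) C suc j
reflection j zero rewrite +-identityʳ j = C-sym j (suc j)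
reflection j (suc h) = begin
  (firstPassages j (2 + h) + firstPassages (suc j) h) + ((j + suc (j + suc h)) C j)
    ≡⟨ cong (λ m → firstPassages j (2 + h) + firstPassages (suc j) h + (m C j)) L≡ ⟩
  (firstPassages j (2 + h) + firstPassages (suc j) h) + (suc L C j)
    ≡⟨ swap (firstPassages j (2 + h)) _ _ ⟩
  (firstPassages j (2 + h) + (suc L C j)) + firstPassages (suc j) h
    ≡⟨ cong (_+ firstPassages (suc j) h) (doubling j) ⟩
  ((L C j) + (L C j)) + firstPassages (suc j) h
    ≡⟨ assoc (L C j) _ ⟩
  (L C j) + (firstPassages (suc j) h + (L C j))
    ≡⟨ cong ((L C j) +_) (reflection j h) ⟩
  (L C j) + (L C suc j)
    ≡⟨ nCk+nC[k+1]≡[n+1]C[k+1] L j ⟩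
  suc L C suc j
    ≡⟨ cong (_C suc j) L≡ ⟨
  (j + suc (j + suc h)) C suc j ∎
  where
  L = j + suc (j + h)
  L≡ : j + suc (j + suc h) ≡ suc L
  L≡ = trans (cong (λ x → j + suc x) (+-suc j h)) (+-suc j (suc (j + h)))
  swap : ∀ a b c → (a + b) + c ≡ (a + c) + b
  swap = solve-∀
  assoc : ∀ a b → (a + a) + b ≡ a + (b + a)
  assoc = solve-∀
  -- For positive `j` this is Pascal's rule together with the induction hypothesis for one up step
  -- fewer, started two levels higher.
  doubling : ∀ j → firstPassages j (2 + h) + (suc (j + suc (j + h)) C j)
             ≡ ((j + suc (j + h)) C j) + ((j + suc (j + h)) C j)
  doubling zero = refl
  doubling (suc i) = begin
    firstPassages (suc i) (2 + h) + (suc M C suc i)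
      ≡⟨ cong (firstPassages (suc i) (2 + h) +_) (sym (nCk+nC[k+1]≡[n+1]C[k+1] M i)) ⟩
    firstPassages (suc i) (2 + h) + ((M C i) + (M C suc i))
      ≡⟨ +-assoc (firstPassages (suc i) (2 + h)) _ _ ⟨
    firstPassages (suc i) (2 + h) + (M C i) + (M C suc i)
      ≡⟨ cong (_+ (M C suc i)) (subst (λ m → firstPassages (suc i) (2 + h) + (m C i) ≡ m C suc i) M≡ (reflection i (2 + h))) ⟩
    (M C suc i) + (M C suc i) ∎
    where
    M = suc i + suc (suc i + h)
    shift : ∀ i h → i + suc (i + (2 + h)) ≡ suc i + suc (suc i + h)
    shift = solve-∀
    M≡ : i + suc (i + (2 + h)) ≡ M
    M≡ = shift i h

-- The ballot formula. The division in `catalanT` is exact because its numerator is `suc (j + i)`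
-- times the number of first passages.
catalanT-firstPassages : ∀ j i → catalanT (j + i) j ≡ firstPassages j (suc i)
catalanT-firstPassages j i = begin
  ((suc (j + i) ∸ j) * ((j + i + j) C (j + i))) / suc (j + i)
    ≡⟨ /-congˡ {o = suc (j + i)} (cong (_* ((j + i + j) C (j + i))) (trans (cong (_∸ j) (sym (+-suc j i))) (m+n∸m≡n j (suc i)))) ⟩
  (suc i * ((j + i + j) C (j + i))) / suc (j + i)
    ≡⟨ /-congˡ {o = suc (j + i)} (scaled j) ⟩
  (firstPassages j (suc i) * suc (j + i)) / suc (j + i)
    ≡⟨ m*n/n≡m (firstPassages j (suc i)) (suc (j + i)) ⟩
  firstPassages j (suc i) ∎
  where
  scaled : ∀ j → suc i * ((j + i + j) C (j + i)) ≡ firstPassages j (suc i) * suc (j + i)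
  scaled zero = begin
    suc i * ((i + 0) C i) ≡⟨ cong (λ m → suc i * (m C i)) (+-identityʳ i) ⟩
    suc i * (i C i)       ≡⟨ cong (suc i *_) (nCn≡1 i) ⟩
    suc i * 1             ≡⟨ *-comm (suc i) 1 ⟩
    1 * suc i             ∎
  -- `reflection` gives the first passages only as the difference of `Y` and `X`; adding the same
  -- multiple of `X` to both sides keeps the computation free of subtraction.
  scaled (suc j) = +-cancelˡ-≡ (suc (suc (j + i)) * X) _ _ (begin
    suc (suc (j + i)) * X + suc i * (N C suc (j + i))
      ≡⟨ cong₂ (λ x y → x + suc i * y) absorb N-sym ⟩
    suc j * Y + suc i * Y
      ≡⟨ collect j i Y ⟩
    suc (suc (j + i)) * Y
      ≡⟨ cong (suc (suc (j + i)) *_) reflected ⟨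
    suc (suc (j + i)) * (firstPassages (suc j) (suc i) + X)
      ≡⟨ expand (suc (suc (j + i))) (firstPassages (suc j) (suc i)) X ⟩
    suc (suc (j + i)) * X + firstPassages (suc j) (suc i) * suc (suc (j + i)) ∎)
    where
    N = suc j + i + suc j
    X = N C j
    Y = N C suc j
    N-sym : N C suc (j + i) ≡ Y
    N-sym = C-sym (suc (j + i)) (suc j)
    N≡ : ∀ j i → j + suc (j + suc i) ≡ suc j + i + suc j
    N≡ = solve-∀
    N≡′ : ∀ j i → j + suc (suc (j + i)) ≡ suc j + i + suc j
    N≡′ = solve-∀
    reflected : firstPassages (suc j) (suc i) + X ≡ Y
    reflected = subst (λ m → firstPassages (suc j) (suc i) + (m C j) ≡ m C suc j) (N≡ j i) (reflection j (suc i))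
    absorb : suc (suc (j + i)) * X ≡ suc j * Y
    absorb = sym (subst (λ m → suc j * (m C suc j) ≡ suc (suc (j + i)) * (m C j)) (N≡′ j i) (C-next j (suc (suc (j + i)))))
    collect : ∀ j i y → suc j * y + suc i * y ≡ suc (suc (j + i)) * y
    collect = solve-∀
    expand : ∀ n f x → n * (f + x) ≡ n * x + f * n
    expand = solve-∀

-- Binomial sums over first passages.

-- Carrying both parts of `u = j + i` avoids the truncated difference `u ∸ j` in the summand.
conv : (ℕ → ℕ → ℕ) → ℕ → ℕ
conv f zero    = f 0 0
conv f (suc u) = f 0 (suc u) + conv (λ j i → f (suc j) i) u

conv-cong : ∀ {f g} u → (∀ j i → j + i ≡ u → f j i ≡ g j i) → conv f u ≡ conv g u
conv-cong zero    f≗g = f≗g 0 0 refl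
conv-cong (suc u) f≗g = cong₂ _+_ (f≗g 0 (suc u) refl) (conv-cong u (λ j i e → f≗g (suc j) i (cong suc e)))

conv-+ : ∀ f g u → conv (λ j i → f j i + g j i) u ≡ conv f u + conv g u
conv-+ f g zero    = refl
conv-+ f g (suc u) = trans (cong (f 0 (suc u) + g 0 (suc u) +_) (conv-+ _ _ u)) (interchange (f 0 (suc u)) _ _ _)
  where
  interchange : ∀ a b c d → (a + b) + (c + d) ≡ (a + c) + (b + d)
  interchange = solve-∀

conv-last : ∀ f u → conv f (suc u) ≡ conv (λ j i → f j (suc i)) u + f (suc u) 0
conv-last f zero    = refl
conv-last f (suc u) = trans (cong (f 0 (suc (suc u)) +_) (conv-last (f ∘ suc) u)) (sym (+-assoc (f 0 (suc (suc u))) _ _))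

conv-applyUpTo : ∀ f u → conv (λ j _ → f j) u ≡ sum (applyUpTo f (suc u))
conv-applyUpTo f zero    = sym (+-identityʳ (f 0))
conv-applyUpTo f (suc u) = cong (f 0 +_) (conv-applyUpTo (f ∘ suc) u)

-- For d = c + 1 this classifies the paths from height c + 1 with u up steps by the
-- number c + j of their down steps from height at least 2: deleting the
-- up steps from height 0 leaves a first passage with j up steps.
binomialSum : ℕ → ℕ → ℕ → ℕ → ℕ
binomialSum c d k = conv (λ j i → ((c + j) C k) * firstPassages j (d + i))

-- Each first passage with an up step is split by its first step. An up step lowers `j` by one,
-- which the weight compensates by raising `c`; the term `j = 0` has the same value at every height
-- and stays with the second sum.
binomialSum-step : ∀ c d k u →
  binomialSum c (suc d) k (suc u) ≡ binomialSum (suc c) (2 + d) k u + binomialSum c d k (suc u)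
binomialSum-step c d k u = begin
  head + conv (λ j i → ((c + suc j) C k) * (firstPassages j (2 + d + i) + firstPassages (suc j) (d + i))) u
    ≡⟨ cong (head +_) (conv-cong u (λ j i _ → split j i)) ⟩
  head + conv (λ j i → ((suc c + j) C k) * firstPassages j (2 + d + i) + ((c + suc j) C k) * firstPassages (suc j) (d + i)) u
    ≡⟨ cong (head +_) (conv-+ _ _ u) ⟩
  head + (binomialSum (suc c) (2 + d) k u + conv (λ j i → ((c + suc j) C k) * firstPassages (suc j) (d + i)) u)
    ≡⟨ swap head (binomialSum (suc c) (2 + d) k u) _ ⟩
  binomialSum (suc c) (2 + d) k u + binomialSum c d k (suc u) ∎
  where
  head = ((c + 0) C k) * 1
  swap : ∀ a b c → a + (b + c) ≡ b + (a + c)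
  swap = solve-∀
  split : ∀ j i → ((c + suc j) C k) * (firstPassages j (2 + d + i) + firstPassages (suc j) (d + i))
    ≡ ((suc c + j) C k) * firstPassages j (2 + d + i) + ((c + suc j) C k) * firstPassages (suc j) (d + i)
  split j i = trans (*-distribˡ-+ ((c + suc j) C k) _ _)
    (cong (λ m → (m C k) * firstPassages j (2 + d + i) + ((c + suc j) C k) * firstPassages (suc j) (d + i)) (+-suc c j))

-- Pascal's rule in each weight is the choice of leaving one further down step unmarked or marking
-- it.
binomialSum-pascal : ∀ c d k u →
  binomialSum (suc c) d (suc k) u ≡ binomialSum c d (suc k) u + binomialSum c d k u
binomialSum-pascal c d k u = trans
  (conv-cong u (λ j i _ → trans
    (cong (_* firstPassages j (d + i))
      (trans (sym (nCk+nC[k+1]≡[n+1]C[k+1] (c + j) k)) (+-comm ((c + j) C k) _)))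
    (*-distribʳ-+ (firstPassages j (d + i)) ((c + j) C suc k) _)))
  (conv-+ _ _ u)

-- The last term vanishes, as no first passage with an up step starts at height 0. For paths this
-- reflects that the step from height 0 must go up.
binomialSum-return : ∀ k u → binomialSum 0 0 k (suc u) ≡ binomialSum 0 1 k u
binomialSum-return k u = begin
  binomialSum 0 0 k (suc u)
    ≡⟨ conv-last (λ j i → (j C k) * firstPassages j i) u ⟩
  binomialSum 0 1 k u + (suc u C k) * 0
    ≡⟨ cong (binomialSum 0 1 k u +_) (*-zeroʳ (suc u C k)) ⟩
  binomialSum 0 1 k u + 0
    ≡⟨ +-identityʳ _ ⟩
  binomialSum 0 1 k u ∎

-- Marked Dyck paths and Borel's triangle.

-- Nonnegative paths of t steps from height c to 0 in which k of the down steps from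
-- height at least 2 are marked.
paths : ℕ → ℕ → ℕ → ℕ
paths zero    zero          zero    = 1
paths zero    zero          (suc k) = 0
paths zero    (suc c)       k       = 0
paths (suc t) zero          k       = paths t 1 k
paths (suc t) (suc zero)    k       = paths t 2 k + paths t 0 k
paths (suc t) (suc (suc c)) zero    = paths t (3 + c) 0 + paths t (suc c) 0
paths (suc t) (suc (suc c)) (suc k) =
  paths t (3 + c) (suc k) + (paths t (suc c) (suc k) + paths t (suc c) k)

paths-too-short : ∀ {t c} k → t < c → paths t c k ≡ 0
paths-too-short {zero}  {suc c}       k       _         = refl
paths-too-short {suc t} {suc zero}    k       (s≤s ())
paths-too-short {suc t} {suc (suc c)} zero    (s≤s t<c) =
  cong₂ _+_ (paths-too-short 0 (m<n⇒m<1+n (m<n⇒m<1+n t<c))) (paths-too-short 0 t<c)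
paths-too-short {suc t} {suc (suc c)} (suc k) (s≤s t<c) =
  cong₂ _+_ (paths-too-short (suc k) (m<n⇒m<1+n (m<n⇒m<1+n t<c)))
    (cong₂ _+_ (paths-too-short (suc k) t<c) (paths-too-short k t<c))

mutual
  paths-zero : ∀ t u k → t ≡ u + u → paths t 0 k ≡ binomialSum 0 0 k u
  paths-zero zero    zero    zero    e = refl
  paths-zero zero    zero    (suc k) e = refl
  paths-zero (suc t) (suc u) k       e = trans
    (paths-suc t u 0 k (trans (suc-injective e) (trans (+-suc u u) (cong suc (sym (+-identityʳ (u + u)))))))
    (sym (binomialSum-return k u))

  -- As the path ends at height 0, its length and initial height determine its number `u` of up
  -- steps. The induction removes the first step, matching `binomialSum-step`.
  paths-suc : ∀ t u c k → t ≡ suc (u + u + c) → paths t (suc c) k ≡ binomialSum c (suc c) k u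
  paths-suc (suc t) zero c k e = trans (paths-down t 0 c k (suc-injective e))
    -- After an up step the remaining length would be less than the height. With `u = 0` the only
    -- first passage is the straight descent, so the remaining sum has the same value from heights
    -- `c` and `suc c`.
    (cong (_+ binomialSum c c k 0) (paths-too-short k (s≤s (m≤n⇒m≤1+n (≤-reflexive (suc-injective e))))))
  paths-suc (suc t) (suc u) c k e = begin
    paths (suc t) (suc c) k
      ≡⟨ paths-down t (suc u) c k (suc-injective e) ⟩
    paths t (2 + c) k + binomialSum c c k (suc u)
      ≡⟨ cong (_+ binomialSum c c k (suc u)) (paths-suc t u (suc c) k (trans (suc-injective e) (shift u c))) ⟩
    binomialSum (suc c) (2 + c) k u + binomialSum c c k (suc u)
      ≡⟨ binomialSum-step c c k u ⟨
    binomialSum c (suc c) k (suc u) ∎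
    where
    shift : ∀ u c → suc u + suc u + c ≡ suc (u + u + suc c)
    shift = solve-∀

  -- The first down step turns into a single sum in every case: from height 1 it carries no mark,
  -- and from a greater height its marked and unmarked versions are merged by `binomialSum-pascal`.
  paths-down : ∀ t u c k → t ≡ u + u + c →
    paths (suc t) (suc c) k ≡ paths t (2 + c) k + binomialSum c c k u
  paths-down t u zero    k       e = cong (paths t 2 k +_) (paths-zero t u k (trans e (+-identityʳ (u + u))))
  -- Without marks every weight is `m C 0`, which is independent of `m`, so `c` can be raised
  -- directly.
  paths-down t u (suc c) zero    e = cong (paths t (3 + c) 0 +_) (paths-suc t u c 0 (trans e (+-suc (u + u) c)))
  paths-down t u (suc c) (suc k) e = cong (paths t (3 + c) (suc k) +_) (trans
    (cong₂ _+_ (paths-suc t u c (suc k) t≡) (paths-suc t u c k t≡))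
    (sym (binomialSum-pascal c (suc c) k u)))
    where
    t≡ = trans e (+-suc (u + u) c)

sum-applyUpTo-skip : ∀ f k m → (∀ j → j < k → f j ≡ 0) →
  sum (applyUpTo f (k + m)) ≡ sum (applyUpTo (f ∘ (k +_)) m)
sum-applyUpTo-skip f zero    m f≡0 = refl
sum-applyUpTo-skip f (suc k) m f≡0 =
  cong₂ _+_ (f≡0 0 z<s) (sum-applyUpTo-skip (f ∘ suc) k m (λ j j<k → f≡0 (suc j) (s<s j<k)))

-- After the forced first up step the sum over the number of markable down steps is the sum defining
-- Borel's triangle, extended by terms with index below `k`, whose binomial coefficients vanish.
borelT-paths : ∀ n k → k ≤ n → borelT n k ≡ paths (2 * suc n) 0 k
borelT-paths n k k≤n = sym (begin
  paths (2 * suc n) 0 k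
    ≡⟨ paths-zero (2 * suc n) (suc n) k (cong (suc n +_) (+-identityʳ (suc n))) ⟩
  binomialSum 0 0 k (suc n)
    ≡⟨ binomialSum-return k n ⟩
  conv (λ j i → (j C k) * firstPassages j (suc i)) n
    ≡⟨ conv-cong n (λ j i e → cong ((j C k) *_)
         (trans (sym (catalanT-firstPassages j i)) (cong (λ m → catalanT m j) e))) ⟩
  conv (λ j _ → f j) n
    ≡⟨ conv-applyUpTo f n ⟩
  sum (applyUpTo f (suc n))
    ≡⟨ cong (sum ∘ applyUpTo f) (m+[n∸m]≡n (m≤n⇒m≤1+n k≤n)) ⟨
  sum (applyUpTo f (k + (suc n ∸ k)))
    ≡⟨ sum-applyUpTo-skip f k (suc n ∸ k) (λ j j<k → cong (_* catalanT n j) (k>n⇒nCk≡0 j<k)) ⟩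
  sum (applyUpTo (f ∘ (k +_)) (suc n ∸ k))
    ≡⟨ cong sum (map-applyUpTo (k +_) f (suc n ∸ k)) ⟨
  borelT n k ∎)
  where
  f : ℕ → ℕ
  f s = (s C k) * catalanT n s

-- Cardinalities by explicit enumeration.

-- Duplicate-free lists are easy to combine under disjoint unions and injective maps, which is how
-- the recurrence for matchings is assembled.
record HasCard {A : Set} (P : A → Set) (n : ℕ) : Set where
  field
    elements : List A
    unique   : Unique elements
    complete : ∀ {x} → P x → x ∈ elements
    sound    : ∀ {x} → x ∈ elements → P x
    size     : length elements ≡ n

card-resp : ∀ {A : Set} {P Q : A → Set} {n} → (∀ {x} → P x → Q x) → (∀ {x} → Q x → P x) →
  HasCard P n → HasCard Q n
card-resp P⇒Q Q⇒P h = record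
  { elements = elements ; unique = unique ; complete = complete ∘ Q⇒P ; sound = P⇒Q ∘ sound ; size = size }
  where open HasCard h

card-empty : ∀ {A : Set} {P : A → Set} → (∀ {x} → ¬ P x) → HasCard P 0
card-empty ¬P = record
  { elements = [] ; unique = [] ; complete = ⊥-elim ∘ ¬P ; sound = λ () ; size = refl }

card-singleton : ∀ {A : Set} (x : A) → HasCard (_≡ x) 1
card-singleton x = record
  { elements = x ∷ [] ; unique = [] ∷ [] ; complete = here ; sound = λ { (here e) → e } ; size = refl }

card-⊎ : ∀ {A : Set} {P Q : A → Set} {m n} → (∀ {x} → P x → ¬ Q x) →
  HasCard P m → HasCard Q n → HasCard (λ x → P x ⊎ Q x) (m + n)
card-⊎ disjoint hP hQ = record
  { elements = P.elements ++ Q.elements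
  ; unique   = Unique.++⁺ P.unique Q.unique (λ { (x∈P , x∈Q) → disjoint (P.sound x∈P) (Q.sound x∈Q) })
  ; complete = [ ∈-++⁺ˡ ∘ P.complete , ∈-++⁺ʳ P.elements ∘ Q.complete ]′
  ; sound    = λ x∈ → [ inj₁ ∘ P.sound , inj₂ ∘ Q.sound ]′ (∈-++⁻ P.elements x∈)
  ; size     = trans (length-++ P.elements) (cong₂ _+_ P.size Q.size)
  }
  where
  module P = HasCard hP
  module Q = HasCard hQ

card-image : ∀ {A B : Set} {P : A → Set} {n} (f : A → B) → (∀ {x y} → f x ≡ f y → x ≡ y) →
  HasCard P n → HasCard (λ y → ∃ λ x → P x × y ≡ f x) n
card-image f f-injective h = record
  { elements = map f elements
  ; unique   = Unique.map⁺ f-injective unique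
  ; complete = λ { (x , Px , refl) → ∈-map⁺ f (complete Px) }
  ; sound    = λ y∈ → let x , x∈ , y≡ = ∈-map⁻ f y∈ in x , sound x∈ , y≡
  ; size     = trans (length-map f elements) size
  }
  where open HasCard h

countB-length : ∀ {A : Set} (p : A → Bool) xs → countB p xs ≡ length (filter (T? ∘ p) xs)
countB-length p []       = refl
countB-length p (x ∷ xs) with p x
... | true  = cong suc (countB-length p xs)
... | false = countB-length p xs

allVec-cartesianProduct : ∀ n m → allVec (suc n) m ≡ cartesianProductWith _∷_ (allFin m) (allVec n m)
allVec-cartesianProduct n m = go (allFin m)
  where
  go : ∀ xs → concatMap (λ x → map (x ∷_) (allVec n m)) xs ≡ cartesianProductWith _∷_ xs (allVec n m)
  go []       = refl
  go (x ∷ xs) = cong (map (x ∷_) (allVec n m) ++_) (go xs)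

∈-allVec : ∀ {n m} (v : Vec (Fin m) n) → v ∈ allVec n m
∈-allVec []      = here refl
∈-allVec {suc n} {m} (x ∷ v) = subst (x ∷ v ∈_) (sym (allVec-cartesianProduct n m))
  (∈-cartesianProductWith⁺ _∷_ (∈-allFin x) (∈-allVec v))

allVec-unique : ∀ n m → Unique (allVec n m)
allVec-unique zero    m = [] ∷ []
allVec-unique (suc n) m = subst Unique (sym (allVec-cartesianProduct n m))
  (Unique.cartesianProductWith⁺ _∷_ ∷-injective (Unique.allFin⁺ m) (allVec-unique n m))

-- The filtered list of all vectors and the enumeration are both duplicate-free with the same
-- members, hence permutations of each other and of equal length.
countB-allVec : ∀ {N n c} {P : Vec (Fin N) n → Set} (p : Vec (Fin N) n → Bool) →
  (∀ {v} → T (p v) → P v) → (∀ {v} → P v → T (p v)) → HasCard P c → countB p (allVec n N) ≡ c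
countB-allVec {N} {n} p p⇒P P⇒p h = trans (countB-length p (allVec n N)) (trans
  (↭-length (∼bag⇒↭ (unique∧set⇒bag (Unique.filter⁺ (T? ∘ p) (allVec-unique n N)) unique
    (mk⇔ (λ v∈ → complete (p⇒P (proj₂ (∈-filter⁻ (T? ∘ p) {xs = allVec n N} v∈))))
         (λ v∈ → ∈-filter⁺ (T? ∘ p) (∈-allVec _) (P⇒p (sound v∈)))))))
  size)
  where open HasCard h

-- Sums of indicators.

ind : Bool → ℕ
ind b = if b then 1 else 0

ind-true : ∀ {b} → T b → ind b ≡ 1
ind-true {true} _ = refl

ind-false : ∀ {b} → ¬ T b → ind b ≡ 0
ind-false {true}  ¬b = contradiction tt ¬b
ind-false {false} ¬b = refl

ind-cong : ∀ {a b} → (T a → T b) → (T b → T a) → ind a ≡ ind b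
ind-cong {true}  a⇒b b⇒a = sym (ind-true (a⇒b tt))
ind-cong {false} a⇒b b⇒a = sym (ind-false b⇒a)

∑-zero : ∀ {n} {f : Fin n → ℕ} → (∀ i → f i ≡ 0) → ∑ f ≡ 0
∑-zero {zero}  f≡0 = refl
∑-zero {suc n} f≡0 = cong₂ _+_ (f≡0 zero) (∑-zero (f≡0 ∘ suc))

term≤∑ : ∀ {n} (f : Fin n → ℕ) i → f i ≤ ∑ f
term≤∑ f zero    = m≤m+n (f zero) _
term≤∑ f (suc i) = ≤-trans (term≤∑ (f ∘ suc) i) (m≤n+m _ (f zero))

∑-ind≤1⁺ : ∀ {n} (p : Fin n → Bool) → (∀ a b → T (p a) → T (p b) → a ≡ b) → ∑ (ind ∘ p) ≤ 1
∑-ind≤1⁺ {zero}  p uniq = z≤n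
∑-ind≤1⁺ {suc n} p uniq with T? (p zero)
... | yes p0 = ≤-reflexive (cong₂ _+_ (ind-true p0)
                 (∑-zero (λ i → ind-false (λ pi → contradiction (uniq zero (suc i) p0 pi) λ ()))))
... | no ¬p0 = subst (λ x → x + ∑ (ind ∘ p ∘ suc) ≤ 1) (sym (ind-false ¬p0))
                 (∑-ind≤1⁺ (p ∘ suc) (λ a b pa pb → Fin.suc-injective (uniq (suc a) (suc b) pa pb)))

∑-ind≤1⁻ : ∀ {n} (p : Fin n → Bool) → ∑ (ind ∘ p) ≤ 1 → ∀ a b → T (p a) → T (p b) → a ≡ b
∑-ind≤1⁻ {suc n} p ∑≤1 zero    zero    pa pb = refl
∑-ind≤1⁻ {suc n} p ∑≤1 zero    (suc b) pa pb = contradiction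
  (≤-trans (+-mono-≤ (≤-reflexive (sym (ind-true pa))) (≤-trans (≤-reflexive (sym (ind-true pb))) (term≤∑ (ind ∘ p ∘ suc) b))) ∑≤1)
  λ { (s≤s ()) }
∑-ind≤1⁻ {suc n} p ∑≤1 (suc a) zero    pa pb = sym (∑-ind≤1⁻ p ∑≤1 zero (suc a) pb pa)
∑-ind≤1⁻ {suc n} p ∑≤1 (suc a) (suc b) pa pb =
  cong suc (∑-ind≤1⁻ (p ∘ suc) (≤-trans (m≤n+m _ (ind (p zero))) ∑≤1) a b pa pb)

-- The half-open interval from `l` to `l + e`, tested by recursion on its lower end so that
-- `∑-inWindow` can count its points by the same recursion.
inWindow : ℕ → ℕ → ℕ → Bool
inWindow zero    e y       = y <ᵇ e
inWindow (suc l) e zero    = false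
inWindow (suc l) e (suc y) = inWindow l e y

inWindow⁻ : ∀ l e y → T (inWindow l e y) → l ≤ y × y < l + e
inWindow⁻ zero    e y       y<e = z≤n , <ᵇ⇒< y e y<e
inWindow⁻ (suc l) e (suc y) t   = let l≤y , y<l+e = inWindow⁻ l e y t in s≤s l≤y , s<s y<l+e

inWindow⁺ : ∀ {l e y} → l ≤ y → y < l + e → T (inWindow l e y)
inWindow⁺ {zero}              l≤y       y<e         = <⇒<ᵇ y<e
inWindow⁺ {suc l} {e} {suc y} (s≤s l≤y) (s<s y<l+e) = inWindow⁺ {l} {e} {y} l≤y y<l+e

∑-inWindow : ∀ N l e → l + e ≤ N → ∑ {N} (λ y → ind (inWindow l e (toℕ y))) ≡ e
∑-inWindow zero    zero    zero    _           = refl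
∑-inWindow (suc N) zero    zero    _           = ∑-inWindow N zero zero z≤n
∑-inWindow (suc N) zero    (suc e) (s≤s e≤N)   = cong suc (∑-inWindow N zero e e≤N)
∑-inWindow (suc N) (suc l) e       (s≤s l+e≤N) = ∑-inWindow N l e l+e≤N

countB-tabulate : ∀ {A : Set} {n} (p : A → Bool) (f : Fin n → A) → countB p (tabulate f) ≡ ∑ (ind ∘ p ∘ f)
countB-tabulate {n = zero}  p f = refl
countB-tabulate {n = suc n} p f = cong (ind (p (f zero)) +_) (countB-tabulate p (f ∘ suc))

sum-tabulate : ∀ {n} (f : Fin n → ℕ) → sum (tabulate f) ≡ ∑ f
sum-tabulate {zero}  f = refl
sum-tabulate {suc n} f = cong (f zero +_) (sum-tabulate (f ∘ suc))

-- The number of crossings or nestings is defined by summing over the covering arc; exchanging the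
-- sums groups the pairs by the covered arc instead.
sum-countB : ∀ {n} (p : Fin n → Fin n → Bool) →
  sum (map (λ a → countB (p a) (allFin n)) (allFin n)) ≡ ∑ (λ b → ∑ (λ a → ind (p a b)))
sum-countB {n} p = begin
  sum (map (λ a → countB (p a) (allFin n)) (allFin n)) ≡⟨ cong sum (map-tabulate id (λ a → countB (p a) (allFin n))) ⟩
  sum (tabulate (λ a → countB (p a) (allFin n)))       ≡⟨ sum-tabulate (λ a → countB (p a) (allFin n)) ⟩
  ∑ (λ a → countB (p a) (allFin n))                    ≡⟨ sum-cong-≗ (λ a → countB-tabulate (p a) id) ⟩
  ∑ (λ a → ∑ (λ b → ind (p a b)))                      ≡⟨ ∑-comm (λ a b → ind (p a b)) ⟩
  ∑ (λ b → ∑ (λ a → ind (p a b)))                      ∎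

-- Matchings and order-preserving insertion of points.

Matching : ∀ {N} → Vec (Fin N) N → Set
Matching v = ∀ i → lookup v (lookup v i) ≡ i × lookup v i ≢ i

vec-ext : ∀ {A : Set} {n} {u v : Vec A n} → (∀ i → lookup u i ≡ lookup v i) → u ≡ v
vec-ext {u = u} {v} u≗v = trans (sym (tabulate∘lookup u)) (trans (tabulate-cong u≗v) (tabulate∘lookup v))

punchIn-<ᶠ : ∀ {n} (p : Fin (suc n)) i j → (punchIn p i <ᶠ punchIn p j) ≡ (i <ᶠ j)
punchIn-<ᶠ zero    i       j       = refl
punchIn-<ᶠ (suc p) zero    zero    = refl
punchIn-<ᶠ (suc p) zero    (suc j) = refl
punchIn-<ᶠ (suc p) (suc i) zero    = refl
punchIn-<ᶠ (suc p) (suc i) (suc j) = punchIn-<ᶠ p i j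

toℕ-punchIn-< : ∀ {n} (p : Fin (suc n)) i → toℕ i < toℕ p → toℕ (punchIn p i) ≡ toℕ i
toℕ-punchIn-< (suc p) zero    _         = refl
toℕ-punchIn-< (suc p) (suc i) (s<s i<p) = cong suc (toℕ-punchIn-< p i i<p)

toℕ-punchIn-≥ : ∀ {n} (p : Fin (suc n)) i → toℕ p ≤ toℕ i → toℕ (punchIn p i) ≡ suc (toℕ i)
toℕ-punchIn-≥ zero    i       _         = refl
toℕ-punchIn-≥ (suc p) (suc i) (s≤s p≤i) = cong suc (toℕ-punchIn-≥ p i p≤i)

i≤punchIn : ∀ {n} (p : Fin (suc n)) i → toℕ i ≤ toℕ (punchIn p i)
i≤punchIn zero    i       = n≤1+n (toℕ i)
i≤punchIn (suc p) zero    = z≤n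
i≤punchIn (suc p) (suc i) = s≤s (i≤punchIn p i)

-- Covering arcs and the degree of an arc.

-- related a b a′ b′ says that the arc (b , b′) is covered by the arc (a , a′).  If t is
-- the last opener of a matching on 2 + M points and its partner is 1 + j, then the arcs
-- covering (t , 1 + j) are those whose closers lie in the interval of length rank M t j
-- beginning at start M t j; position M t is the inverse of rank M t.
record Statistic : Set where
  field
    related       : ∀ {N} → (a b a′ b′ : Fin N) → Bool
    related-embed : ∀ {M N} (f : Fin M → Fin N) → (∀ i j → (f i <ᶠ f j) ≡ (i <ᶠ j)) →
                    ∀ a b a′ b′ → related (f a) (f b) (f a′) (f b′) ≡ related a b a′ b′
    related⇒<     : ∀ {N} {a b a′ b′ : Fin N} → T (related a b a′ b′) →
                    toℕ a < toℕ b × toℕ b < toℕ a′ × toℕ b < toℕ b′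
    rank          : (M t j : ℕ) → ℕ
    position      : (M t e : ℕ) → ℕ
    rank≤         : ∀ {c t j} → t ≤ j → j ≤ t + c → rank (t + c) t j ≤ c
    position-≥    : ∀ {c t e} → e ≤ c → t ≤ position (t + c) t e
    position-≤    : ∀ {c t e} → e ≤ c → position (t + c) t e ≤ t + c
    rank-position : ∀ {c t e} → e ≤ c → rank (t + c) t (position (t + c) t e) ≡ e
    position-rank : ∀ {c t j} → t ≤ j → j ≤ t + c → position (t + c) t (rank (t + c) t j) ≡ j
    start         : (M t j : ℕ) → ℕ
    start-bound   : ∀ {M t j} → t ≤ j → j ≤ M → start M t j + rank M t j ≤ 2 + M
    window⁻       : ∀ {M j} {a b a′ b′ : Fin (2 + M)} → toℕ b ≤ j → j ≤ M → toℕ b′ ≡ suc j →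
                    T (related a b a′ b′) →
                    start M (toℕ b) j ≤ toℕ a′ × toℕ a′ < start M (toℕ b) j + rank M (toℕ b) j
    window⁺       : ∀ {M j} {a b a′ b′ : Fin (2 + M)} → toℕ b ≤ j → j ≤ M → toℕ b′ ≡ suc j →
                    (toℕ b < toℕ a′ → a′ ≢ b′ → toℕ a < toℕ b) →
                    start M (toℕ b) j ≤ toℕ a′ → toℕ a′ < start M (toℕ b) j + rank M (toℕ b) j →
                    T (related a b a′ b′)

module Counting (S : Statistic) where
  open Statistic S

  degree : ∀ {N} → Vec (Fin N) N → Fin N → ℕ
  degree v b = ∑ (λ a → ind (related a b (lookup v a) (lookup v b)))

  ClosersFrom : ∀ {N} → ℕ → Vec (Fin N) N → Set
  ClosersFrom t v = ∀ x → t ≤ toℕ x → toℕ (lookup v x) < toℕ x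

  -- The state of the reading from right to left: with `N = t + c`, the last `c` points are known to
  -- be closers, and `c` is the current height of the path.
  record Good {N} (t k : ℕ) (v : Vec (Fin N) N) : Set where
    constructor good
    field
      matching : Matching v
      closers  : ClosersFrom t v
      degree≤1 : ∀ b → degree v b ≤ 1
      total    : ∑ (degree v) ≡ k

  degree-closer : ∀ {N} (v : Vec (Fin N) N) b → toℕ (lookup v b) < toℕ b → degree v b ≡ 0
  degree-closer v b vb<b = ∑-zero λ a → ind-false λ r → <-asym vb<b (proj₂ (proj₂ (related⇒< {a = a} r)))

  -- The involution `lookup v` permutes the points, so the covering arcs can be counted by their
  -- closers, and these are exactly the points of the window.
  degree-last-opener : ∀ {M} (v : Vec (Fin (2 + M)) (2 + M)) p j → Matching v →
    ClosersFrom (suc (toℕ p)) v → toℕ p ≤ j → j ≤ M → toℕ (lookup v p) ≡ suc j →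
    degree v p ≡ rank M (toℕ p) j
  degree-last-opener {M} v p j m cl p≤j j≤M vp≡ = begin
    degree v p
      ≡⟨ sum-cong-≗ (λ a → ind-cong
           (λ r → let lo , hi = window⁻ p≤j j≤M vp≡ r in inWindow⁺ lo hi)
           (λ w → let lo , hi = inWindow⁻ (start M (toℕ p) j) (rank M (toℕ p) j) _ w in window⁺ p≤j j≤M vp≡ (opens a) lo hi)) ⟩
    ∑ (λ a → ind (inWindow (start M (toℕ p) j) (rank M (toℕ p) j) (toℕ (lookup v a))))
      ≡⟨ sum-permute (λ y → ind (inWindow (start M (toℕ p) j) (rank M (toℕ p) j) (toℕ y)))
           (permutation (lookup v) (lookup v) (proj₁ ∘ m) (proj₁ ∘ m)) ⟨
    ∑ {2 + M} (λ y → ind (inWindow (start M (toℕ p) j) (rank M (toℕ p) j) (toℕ y)))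
      ≡⟨ ∑-inWindow (2 + M) (start M (toℕ p) j) (rank M (toℕ p) j) (start-bound p≤j j≤M) ⟩
    rank M (toℕ p) j ∎
    where
    -- If `a` lay beyond `p`, then `a` and its partner would both be closers, each preceding the
    -- other.
    opens : ∀ a → toℕ p < toℕ (lookup v a) → lookup v a ≢ lookup v p → toℕ a < toℕ p
    opens a p<va va≢vp with <-cmp (toℕ a) (toℕ p)
    ... | tri< a<p _ _ = a<p
    ... | tri≈ _ a≡p _ = contradiction (cong (lookup v) (toℕ-injective a≡p)) va≢vp
    ... | tri> _ _ p<a = contradiction (cl a p<a)
      (<-asym (subst (λ x → toℕ x < toℕ (lookup v a)) (proj₁ (m a)) (cl (lookup v a) p<va)))

  -- Insertion and deletion of the arc of the last opener.

  -- The closer is given by its index `q′` among the points other than `p`; as `p` precedes it, its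
  -- actual index is one larger.
  module InsertArc {M} (p : Fin (2 + M)) (q′ : Fin (1 + M)) (p≤q′ : toℕ p ≤ toℕ q′) where

    q : Fin (2 + M)
    q = punchIn p q′

    toℕ-q : toℕ q ≡ suc (toℕ q′)
    toℕ-q = toℕ-punchIn-≥ p q′ p≤q′

    p<q : toℕ p < toℕ q
    p<q = subst (toℕ p <_) (sym toℕ-q) (s≤s p≤q′)

    embed : Fin M → Fin (2 + M)
    embed i = punchIn p (punchIn q′ i)

    embed-<ᶠ : ∀ i j → (embed i <ᶠ embed j) ≡ (i <ᶠ j)
    embed-<ᶠ i j = trans (punchIn-<ᶠ p (punchIn q′ i) (punchIn q′ j)) (punchIn-<ᶠ q′ i j)

    embed-< : ∀ {i j} → toℕ i < toℕ j → toℕ (embed i) < toℕ (embed j)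
    embed-< {i} {j} i<j = <ᵇ⇒< _ _ (subst T (sym (embed-<ᶠ i j)) (<⇒<ᵇ i<j))

    embed-<⁻ : ∀ {i j} → toℕ (embed i) < toℕ (embed j) → toℕ i < toℕ j
    embed-<⁻ {i} {j} i<j = <ᵇ⇒< _ _ (subst T (embed-<ᶠ i j) (<⇒<ᵇ i<j))

    embed-injective : ∀ {i j} → embed i ≡ embed j → i ≡ j
    embed-injective = punchIn-injective q′ _ _ ∘ punchIn-injective p _ _

    embed≢p : ∀ i → embed i ≢ p
    embed≢p i = punchInᵢ≢i p (punchIn q′ i)

    embed≢q : ∀ i → embed i ≢ q
    embed≢q i e = punchInᵢ≢i q′ i (punchIn-injective p _ _ e)

    embed-above : ∀ i → toℕ p ≤ toℕ i → toℕ p < toℕ (embed i)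
    embed-above i p≤i = subst (toℕ p <_) (sym (toℕ-punchIn-≥ p (punchIn q′ i) p≤)) (s≤s p≤)
      where p≤ = ≤-trans p≤i (i≤punchIn q′ i)

    embed-above⁻ : ∀ i → toℕ p < toℕ (embed i) → toℕ p ≤ toℕ i
    embed-above⁻ i p<ei = ≮⇒≥ λ i<p →
      let e  = toℕ-punchIn-< q′ i (<-≤-trans i<p p≤q′)
          e′ = toℕ-punchIn-< p (punchIn q′ i) (subst (_< toℕ p) (sym e) i<p)
      in <-asym i<p (subst (toℕ p <_) (trans e′ e) p<ei)

    data View : Fin (2 + M) → Set where
      is-p     : View p
      is-q     : View q
      is-embed : ∀ i → View (embed i)

    view : ∀ x → View x
    view x with p Fin.≟ x
    ... | yes refl = is-p
    ... | no  p≢x with q′ Fin.≟ punchOut p≢x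
    ...   | yes e    = subst View (trans (cong (punchIn p) e) (punchIn-punchOut p≢x)) is-q
    ...   | no  q′≢y = subst View (trans (cong (punchIn p) (punchIn-punchOut q′≢y)) (punchIn-punchOut p≢x)) (is-embed (punchOut q′≢y))

    insert : Vec (Fin M) M → Vec (Fin (2 + M)) (2 + M)
    insert u = insertAt (insertAt (mapᵥ embed u) q′ p) p q

    insert-p : ∀ u → lookup (insert u) p ≡ q
    insert-p u = insertAt-lookup _ p q

    insert-q : ∀ u → lookup (insert u) q ≡ p
    insert-q u = trans (insertAt-punchIn _ p q q′) (insertAt-lookup _ q′ p)

    insert-embed : ∀ u i → lookup (insert u) (embed i) ≡ embed (lookup u i)
    insert-embed u i = trans (insertAt-punchIn _ p q (punchIn q′ i))
      (trans (insertAt-punchIn _ q′ p i) (lookup-map i embed u))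

    insert-injective : ∀ {u w} → insert u ≡ insert w → u ≡ w
    insert-injective {u} {w} e = vec-ext λ i → embed-injective
      (trans (sym (insert-embed u i)) (trans (cong (λ v → lookup v (embed i)) e) (insert-embed w i)))

    -- Since `p` and `q` are partners of each other, every other point has its partner in the image
    -- of `embed`, and these partners form the smaller matching.
    insert-surjective : ∀ v → Matching v → lookup v p ≡ q → ∃ λ u → v ≡ insert u
    insert-surjective v m vp≡q = u , vec-ext agree
      where
      vq≡p : lookup v q ≡ p
      vq≡p = trans (cong (lookup v) (sym vp≡q)) (proj₁ (m p))

      preimage : ∀ i → ∃ λ j → lookup v (embed i) ≡ embed j
      preimage i with lookup v (embed i) in e | view (lookup v (embed i))
      ... | _ | is-p       = contradiction (trans (sym (proj₁ (m (embed i)))) (trans (cong (lookup v) e) vp≡q)) (embed≢q i)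
      ... | _ | is-q       = contradiction (trans (sym (proj₁ (m (embed i)))) (trans (cong (lookup v) e) vq≡p)) (embed≢p i)
      ... | _ | is-embed j = j , refl

      u : Vec (Fin M) M
      u = tabulateᵥ (proj₁ ∘ preimage)

      agree : ∀ x → lookup v x ≡ lookup (insert u) x
      agree x with view x
      ... | is-p       = trans vp≡q (sym (insert-p u))
      ... | is-q       = trans vq≡p (sym (insert-q u))
      ... | is-embed i = trans (proj₂ (preimage i))
        (trans (cong embed (sym (lookup∘tabulate (proj₁ ∘ preimage) i))) (sym (insert-embed u i)))

    insert-matching⁺ : ∀ {u} → Matching u → Matching (insert u)
    insert-matching⁺ {u} m x with view x
    ... | is-p = trans (cong (lookup (insert u)) (insert-p u)) (insert-q u)
               , λ e → punchInᵢ≢i p q′ (trans (sym (insert-p u)) e)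
    ... | is-q = trans (cong (lookup (insert u)) (insert-q u)) (insert-p u)
               , λ e → punchInᵢ≢i p q′ (trans (sym e) (insert-q u))
    ... | is-embed i =
        trans (cong (lookup (insert u)) (insert-embed u i)) (trans (insert-embed u (lookup u i)) (cong embed (proj₁ (m i))))
      , λ e → proj₂ (m i) (embed-injective (trans (sym (insert-embed u i)) e))

    insert-matching⁻ : ∀ {u} → Matching (insert u) → Matching u
    insert-matching⁻ {u} m i =
        embed-injective (trans (sym (insert-embed u (lookup u i))) (trans (cong (lookup (insert u)) (sym (insert-embed u i))) (proj₁ (m (embed i)))))
      , λ e → proj₂ (m (embed i)) (trans (insert-embed u i) (cong embed e))

    insert-closers⁺ : ∀ {u} → ClosersFrom (toℕ p) u → ClosersFrom (suc (toℕ p)) (insert u)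
    insert-closers⁺ {u} cl x p<x with view x
    ... | is-p       = contradiction p<x (<-irrefl refl)
    ... | is-q       = subst (λ y → toℕ y < toℕ q) (sym (insert-q u)) p<q
    ... | is-embed i = subst (λ y → toℕ y < toℕ (embed i)) (sym (insert-embed u i)) (embed-< (cl i (embed-above⁻ i p<x)))

    insert-closers⁻ : ∀ {u} → ClosersFrom (suc (toℕ p)) (insert u) → ClosersFrom (toℕ p) u
    insert-closers⁻ {u} cl i p≤i = embed-<⁻
      (subst (λ y → toℕ y < toℕ (embed i)) (insert-embed u i) (cl (embed i) (embed-above i p≤i)))

    module _ {u} (m : Matching (insert u)) (cl : ClosersFrom (suc (toℕ p)) (insert u)) where

      degree-p : degree (insert u) p ≡ rank M (toℕ p) (toℕ q′)
      degree-p = degree-last-opener (insert u) p (toℕ q′) m cl p≤q′ (≤-pred (toℕ<n q′)) (trans (cong toℕ (insert-p u)) toℕ-q)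

      degree-q : degree (insert u) q ≡ 0
      degree-q = degree-closer (insert u) q (cl q p<q)

      ∑-split : ∀ (f : Fin (2 + M) → ℕ) → ∑ f ≡ f p + (f q + ∑ (f ∘ embed))
      ∑-split f = trans (sum-remove {i = p} f) (cong (f p +_) (sum-remove {i = q′} (f ∘ punchIn p)))

      -- The new arc covers nothing: an arc covered by it would open after `p`, where all points are
      -- closers. The old arcs keep their relations because `embed` preserves order.
      degree-embed : ∀ i → degree (insert u) (embed i) ≡ degree u i
      degree-embed i = begin
        degree (insert u) (embed i)
          ≡⟨ ∑-split term ⟩
        term p + (term q + ∑ (term ∘ embed))
          ≡⟨ cong₂ (λ x y → x + (y + ∑ (term ∘ embed))) (ind-false p-unrelated) (ind-false q-unrelated) ⟩
        ∑ (term ∘ embed)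
          ≡⟨ sum-cong-≗ (λ a → cong ind (trans
               (cong₂ (related (embed a) (embed i)) (insert-embed u a) (insert-embed u i))
               (related-embed embed embed-<ᶠ a i (lookup u a) (lookup u i)))) ⟩
        degree u i ∎
        where
        term : Fin (2 + M) → ℕ
        term a = ind (related a (embed i) (lookup (insert u) a) (lookup (insert u) (embed i)))

        p-unrelated : ¬ T (related p (embed i) (lookup (insert u) p) (lookup (insert u) (embed i)))
        p-unrelated r = let p<i , _ , i<vi = related⇒< r in <-asym i<vi (cl (embed i) p<i)

        q-unrelated : ¬ T (related q (embed i) (lookup (insert u) q) (lookup (insert u) (embed i)))
        q-unrelated r = let q<i , i<vq , _ = related⇒< r in
          <-asym (<-trans q<i i<vq) (subst (λ y → toℕ y < toℕ q) (sym (insert-q u)) p<q)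

      total-insert : ∑ (degree (insert u)) ≡ rank M (toℕ p) (toℕ q′) + ∑ (degree u)
      total-insert = trans (∑-split (degree (insert u)))
        (cong₂ _+_ degree-p (cong₂ _+_ degree-q (sum-cong-≗ degree-embed)))

    insert-good⁺ : ∀ {u k} → rank M (toℕ p) (toℕ q′) ≤ 1 → Good (toℕ p) k u →
      Good (suc (toℕ p)) (rank M (toℕ p) (toℕ q′) + k) (insert u)
    insert-good⁺ {u} r≤1 (good m cl d≤1 refl) = good m′ cl′ d′≤1 (total-insert m′ cl′)
      where
      m′  = insert-matching⁺ m
      cl′ = insert-closers⁺ cl
      d′≤1 : ∀ b → degree (insert u) b ≤ 1
      d′≤1 b with view b
      ... | is-p       = subst (_≤ 1) (sym (degree-p m′ cl′)) r≤1
      ... | is-q       = subst (_≤ 1) (sym (degree-q m′ cl′)) z≤n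
      ... | is-embed i = subst (_≤ 1) (sym (degree-embed m′ cl′ i)) (d≤1 i)

    insert-good⁻ : ∀ {u k} → Good (suc (toℕ p)) k (insert u) →
      Good (toℕ p) (∑ (degree u)) u × k ≡ rank M (toℕ p) (toℕ q′) + ∑ (degree u)
    insert-good⁻ {u} (good m cl d≤1 total) =
        good (insert-matching⁻ m) (insert-closers⁻ cl) (λ i → subst (_≤ 1) (degree-embed m cl i) (d≤1 (embed i))) refl
      , trans (sym total) (total-insert m cl)

    -- Insertion is a bijection onto the matchings that contain the arc (p, q), and it raises the
    -- total by the degree of `p`, which is the rank `e`.
    card-opener : ∀ {e k n} → e ≤ 1 → rank M (toℕ p) (toℕ q′) ≡ e → HasCard (Good {M} (toℕ p) k) n →
      HasCard (λ v → Good (suc (toℕ p)) (e + k) v × lookup v p ≡ q) n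
    card-opener {k = k} e≤1 refl h = card-resp
      (λ { (u , g , refl) → insert-good⁺ e≤1 g , insert-p u })
      (λ { (g , vp≡q) → reconstruct g vp≡q })
      (card-image insert insert-injective h)
      where
      reconstruct : ∀ {v} → Good (suc (toℕ p)) (rank M (toℕ p) (toℕ q′) + k) v → lookup v p ≡ q →
        ∃ λ u → Good (toℕ p) k u × v ≡ insert u
      reconstruct {v} g vp≡q with insert-surjective v (Good.matching g) vp≡q
      ... | u , refl = let g′ , e = insert-good⁻ g in
        u , subst (λ x → Good (toℕ p) x u) (sym (+-cancelˡ-≡ (rank M (toℕ p) (toℕ q′)) _ _ e)) g′ , refl

  -- The recurrence for admissible matchings.

  good-closer : ∀ {N t k} {v : Vec (Fin N) N} (p : Fin N) → toℕ p ≡ t → toℕ (lookup v p) < toℕ p →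
    Good (suc t) k v → Good t k v
  good-closer {t = t} {v = v} p p≡t vp<p (good m cl d tot) = good m cl′ d tot
    where
    cl′ : ClosersFrom t v
    cl′ x t≤x with m≤n⇒m<n∨m≡n t≤x
    ... | inj₁ t<x = cl x t<x
    ... | inj₂ t≡x with toℕ-injective (trans p≡t t≡x)
    ...   | refl = vp<p

  good-suc : ∀ {N t k} {v : Vec (Fin N) N} → Good t k v → Good (suc t) k v
  good-suc (good m cl d tot) = good m (λ x t<x → cl x (<⇒≤ t<x)) d tot

  -- The point `p` is followed by `suc c` points, so the rank of its partner ranges from 0 to `c`.
  module LastOpener (t c : ℕ) where

    p : Fin (2 + (t + c))
    p = fromℕ< (m<n⇒m<1+n (s≤s (m≤m+n t c)))

    toℕ-p : toℕ p ≡ t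
    toℕ-p = toℕ-fromℕ< _

    module At {e} (e≤c : e ≤ c) where

      q′ : Fin (1 + (t + c))
      q′ = fromℕ< (s≤s (position-≤ {c} {t} e≤c))

      toℕ-q′ : toℕ q′ ≡ position (t + c) t e
      toℕ-q′ = toℕ-fromℕ< _

      p≤q′ : toℕ p ≤ toℕ q′
      p≤q′ = subst₂ _≤_ (sym toℕ-p) (sym toℕ-q′) (position-≥ {c} {t} e≤c)

      open InsertArc p q′ p≤q′ public using (q; p<q)

      card : ∀ {k n} → e ≤ 1 → HasCard (Good {t + c} t k) n →
        HasCard (λ v → Good (suc t) (e + k) v × lookup v p ≡ q) n
      card {k} {n} e≤1 h = subst (λ s → HasCard (λ v → Good (suc s) (e + k) v × lookup v p ≡ q) n) toℕ-p
        (InsertArc.card-opener p q′ p≤q′ e≤1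
          (trans (cong₂ (rank (t + c)) toℕ-p toℕ-q′) (rank-position {c} {t} e≤c))
          (subst (λ s → HasCard (Good {t + c} s k) n) (sym toℕ-p) h))

    Partner : ℕ → Vec (Fin (2 + (t + c))) (2 + (t + c)) → Set
    Partner k v = Σ ℕ λ e → Σ (e ≤ c) λ e≤c → e ≤ 1 × e ≤ k × lookup v p ≡ At.q e≤c

    -- The rank of the partner is the degree of `p`: it is at most 1 by the degree bound and at most
    -- `k` as a term of the total. Since `position` inverts `rank`, it determines the partner.
    partner : ∀ {k v} → Good (suc t) k v → toℕ p < toℕ (lookup v p) → Partner k v
    partner {k} {v} g p<vp = e , e≤c , e≤1 , e≤k , vp≡
      where
      open Good g
      p≢vp : p ≢ lookup v p
      p≢vp = proj₂ (matching p) ∘ sym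

      r = punchOut p≢vp

      r-in : punchIn p r ≡ lookup v p
      r-in = punchIn-punchOut p≢vp

      p≤r : toℕ p ≤ toℕ r
      p≤r = ≮⇒≥ λ r<p → <-asym r<p (subst (toℕ p <_) (trans (cong toℕ (sym r-in)) (toℕ-punchIn-< p r r<p)) p<vp)

      t≤r : t ≤ toℕ r
      t≤r = subst (_≤ toℕ r) toℕ-p p≤r

      r≤ : toℕ r ≤ t + c
      r≤ = ≤-pred (toℕ<n r)

      e   = rank (t + c) t (toℕ r)
      e≤c = rank≤ {c} {t} t≤r r≤

      degree≡e : degree v p ≡ e
      degree≡e = trans
        (degree-last-opener v p (toℕ r) matching (subst (λ s → ClosersFrom (suc s) v) (sym toℕ-p) closers) p≤r r≤
          (trans (cong toℕ (sym r-in)) (toℕ-punchIn-≥ p r p≤r)))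
        (cong (λ s → rank (t + c) s (toℕ r)) toℕ-p)

      e≤1 : e ≤ 1
      e≤1 = subst (_≤ 1) degree≡e (degree≤1 p)

      e≤k : e ≤ k
      e≤k = subst₂ _≤_ degree≡e total (term≤∑ (degree v) p)

      vp≡ : lookup v p ≡ At.q e≤c
      vp≡ = trans (sym r-in) (cong (punchIn p)
        (toℕ-injective (trans (sym (position-rank {c} {t} t≤r r≤)) (sym (At.toℕ-q′ e≤c)))))

    q-injective : ∀ {e e′} (l : e ≤ c) (l′ : e′ ≤ c) → At.q l ≡ At.q l′ → e ≡ e′
    q-injective l l′ eq = trans (sym (rank-position {c} {t} l)) (trans
      (cong (rank (t + c) t) (trans (sym (At.toℕ-q′ l)) (trans (cong toℕ (punchIn-injective p _ _ eq)) (At.toℕ-q′ l′))))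
      (rank-position {c} {t} l′))

    closer-or-opener : ∀ {k v} → Good (suc t) k v → Good t k v ⊎ toℕ p < toℕ (lookup v p)
    closer-or-opener {v = v} g with <-cmp (toℕ (lookup v p)) (toℕ p)
    ... | tri< vp<p _ _ = inj₁ (good-closer p toℕ-p vp<p g)
    ... | tri≈ _ vp≡p _ = contradiction (toℕ-injective vp≡p) (proj₂ (Good.matching g p))
    ... | tri> _ _ p<vp = inj₂ p<vp

    card-step : ∀ {k m n} → HasCard (Good t k) m → HasCard (λ v → Good (suc t) k v × toℕ p < toℕ (lookup v p)) n →
      HasCard (Good (suc t) k) (m + n)
    card-step h h′ = card-resp [ good-suc , proj₁ ]′
      (λ g → [ inj₁ , (λ p<vp → inj₂ (g , p<vp)) ]′ (closer-or-opener g))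
      (card-⊎ (λ { g (_ , p<vp) → <-asym p<vp (Good.closers g p (≤-reflexive (sym toℕ-p))) }) h h′)

    -- A positive rank would force both `c` and `k` to be positive.
    card-rank0 : ∀ {k n} → c ≡ 0 ⊎ k ≡ 0 → HasCard (Good {t + c} t k) n →
      HasCard (λ v → Good (suc t) k v × toℕ p < toℕ (lookup v p)) n
    card-rank0 {k} c≡0∨k≡0 h = card-resp
      (λ { (g , vp≡q) → g , subst (λ y → toℕ p < toℕ y) (sym vp≡q) (At.p<q z≤n) })
      (λ { {v} (g , p<vp) → g , rank0 {v} (partner g p<vp) })
      (At.card z≤n z≤n h)
      where
      rank0 : ∀ {v} → Partner k v → lookup v p ≡ At.q z≤n
      rank0 (zero  , z≤n , _ , _   , vp≡q) = vp≡q
      rank0 (suc e , e≤c , _ , e≤k , vp≡q) = ⊥-elim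
        ([ (λ c≡0 → n≮0 (subst (e <_) c≡0 e≤c)) , (λ k≡0 → n≮0 (subst (e <_) k≡0 e≤k)) ]′ c≡0∨k≡0)

    card-rank≤1 : ∀ {k m n} (1≤c : 1 ≤ c) → HasCard (Good {t + c} t (suc k)) m → HasCard (Good {t + c} t k) n →
      HasCard (λ v → Good (suc t) (suc k) v × toℕ p < toℕ (lookup v p)) (m + n)
    card-rank≤1 {k} 1≤c h h′ = card-resp
      [ (λ { (g , vp≡q) → g , subst (λ y → toℕ p < toℕ y) (sym vp≡q) (At.p<q z≤n) })
      , (λ { (g , vp≡q) → g , subst (λ y → toℕ p < toℕ y) (sym vp≡q) (At.p<q 1≤c) }) ]′
      (λ { (g , p<vp) → rank0-or-1 g (partner g p<vp) })
      (card-⊎ (λ { (_ , e) (_ , e′) → contradiction (q-injective z≤n 1≤c (trans (sym e) e′)) λ () })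
        (At.card z≤n z≤n h) (At.card 1≤c ≤-refl h′))
      where
      rank0-or-1 : ∀ {v} → Good (suc t) (suc k) v → Partner (suc k) v →
        (Good (suc t) (suc k) v × lookup v p ≡ At.q z≤n) ⊎ (Good (suc t) (suc k) v × lookup v p ≡ At.q 1≤c)
      rank0-or-1 g (zero        , z≤n , _      , _ , vp≡q) = inj₁ (g , vp≡q)
      rank0-or-1 g (suc zero    , e≤c , _      , _ , vp≡q) =
        inj₂ (g , trans vp≡q (cong (λ l → At.q l) (≤-irrelevant e≤c 1≤c)))
      rank0-or-1 g (suc (suc e) , e≤c , s≤s () , _ , vp≡q)

  -- Induction on the number `t` of points still to be read. If the next point is a closer, the
  -- height rises; if it is an opener, its arc is deleted and the height falls. A partner of rank 1
  -- corresponds to a marked down step.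
  card-good : ∀ {N} t c k → N ≡ t + c → HasCard (Good {N} t k) (paths t c k)
  card-good zero zero zero refl = card-resp
    (λ { refl → good (λ ()) (λ ()) (λ ()) refl }) (λ { {[]} _ → refl }) (card-singleton [])
  card-good zero zero (suc k) refl = card-empty λ { {[]} (good _ _ _ ()) }
  card-good zero (suc c) k refl = card-empty λ { (good _ cl _ _) → contradiction (cl zero z≤n) λ () }
  -- At height 0 the point read is the last one, so its partner precedes it.
  card-good (suc t) zero k eq with refl ← trans eq (cong suc (+-identityʳ t)) = card-resp good-suc
    (λ { {v} g → good-closer p toℕ-p (vp<p g) g })
    (card-good t 1 k (sym (+-comm t 1)))
    where
    p : Fin (suc t)
    p = fromℕ< ≤-refl
    toℕ-p : toℕ p ≡ t
    toℕ-p = toℕ-fromℕ< _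
    vp<p : ∀ {v} → Good (suc t) k v → toℕ (lookup v p) < toℕ p
    vp<p {v} g = ≤∧≢⇒< (subst (toℕ (lookup v p) ≤_) (sym toℕ-p) (≤-pred (toℕ<n (lookup v p))))
      (proj₂ (Good.matching g p) ∘ toℕ-injective)
  -- The parameter of `LastOpener` is one less than the height; here a single closer follows, and
  -- rank 0 is the only choice.
  card-good (suc t) (suc zero) k eq with refl ← trans eq (cong suc (+-suc t 0)) =
    card-step (card-good t 2 k (sym (trans (+-suc t 1) (cong suc (+-suc t 0)))))
      (card-rank0 (inj₁ refl) (card-good t 0 k refl))
    where open LastOpener t 0
  card-good (suc t) (suc (suc c)) zero eq with refl ← trans eq (cong suc (+-suc t (suc c))) =
    card-step (card-good t (3 + c) 0 (sym (trans (+-suc t (2 + c)) (cong suc (+-suc t (suc c))))))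
      (card-rank0 (inj₂ refl) (card-good t (suc c) 0 refl))
    where open LastOpener t (suc c)
  card-good (suc t) (suc (suc c)) (suc k) eq with refl ← trans eq (cong suc (+-suc t (suc c))) =
    card-step (card-good t (3 + c) (suc k) (sym (trans (+-suc t (2 + c)) (cong suc (+-suc t (suc c))))))
      (card-rank≤1 (s≤s z≤n) (card-good t (suc c) (suc k) refl) (card-good t (suc c) k refl))
    where open LastOpener t (suc c)

  -- Two covering arcs can be ordered by their openers, and their closers differ because a matching
  -- is injective. Only the order of the closers is left to be examined.
  degree≤1⁺ : ∀ {N} (v : Vec (Fin N) N) → Matching v →
    (∀ a a′ b → toℕ a < toℕ a′ → lookup v a ≢ lookup v a′ →
      T (related a b (lookup v a) (lookup v b)) → ¬ T (related a′ b (lookup v a′) (lookup v b))) →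
    ∀ b → degree v b ≤ 1
  degree≤1⁺ v m no-pair b = ∑-ind≤1⁺ (λ a → related a b (lookup v a) (lookup v b)) λ a a′ r r′ → coincide a a′ r r′ (<-cmp (toℕ a) (toℕ a′))
    where
    distinct : ∀ {a a′} → toℕ a < toℕ a′ → lookup v a ≢ lookup v a′
    distinct {a} {a′} a<a′ e = <-irrefl (cong toℕ (trans (sym (proj₁ (m a))) (trans (cong (lookup v) e) (proj₁ (m a′))))) a<a′

    coincide : ∀ a a′ → T (related a b (lookup v a) (lookup v b)) → T (related a′ b (lookup v a′) (lookup v b)) →
      Tri (toℕ a < toℕ a′) (toℕ a ≡ toℕ a′) (toℕ a > toℕ a′) → a ≡ a′
    coincide a a′ r r′ (tri< a<a′ _ _) = ⊥-elim (no-pair a a′ b a<a′ (distinct a<a′) r r′)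
    coincide a a′ r r′ (tri≈ _ a≡a′ _) = toℕ-injective a≡a′
    coincide a a′ r r′ (tri> _ _ a>a′) = ⊥-elim (no-pair a′ a b a>a′ (distinct a>a′) r′ r)

  degree≤1⁻ : ∀ {N} (v : Vec (Fin N) N) → (∀ b → degree v b ≤ 1) → ∀ {a a′ b} → toℕ a < toℕ a′ →
    T (related a b (lookup v a) (lookup v b)) → ¬ T (related a′ b (lookup v a′) (lookup v b))
  degree≤1⁻ v d≤1 {a} {a′} {b} a<a′ r r′ = <-irrefl (cong toℕ (∑-ind≤1⁻ (λ a → related a b (lookup v a) (lookup v b)) (d≤1 b) a a′ r r′)) a<a′

-- Boolean tests and the properties they decide.

infixr 6 _&_

_&_ : ∀ {x y} → T x → T y → T (x ∧ y)
tx & ty = from T-∧ (tx , ty)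

<ᶠ⇒< : ∀ {N} (i j : Fin N) → T (i <ᶠ j) → toℕ i < toℕ j
<ᶠ⇒< i j = <ᵇ⇒< (toℕ i) (toℕ j)

=ᶠ⇒≡ : ∀ {N} (i j : Fin N) → T (i =ᶠ j) → i ≡ j
=ᶠ⇒≡ i j = toℕ-injective ∘ ≡ᵇ⇒≡ (toℕ i) (toℕ j)

≡⇒=ᶠ : ∀ {N} (i j : Fin N) → i ≡ j → T (i =ᶠ j)
≡⇒=ᶠ i j = ≡⇒≡ᵇ (toℕ i) (toℕ j) ∘ cong toℕ

T-if-not⁺ : ∀ {b} → ¬ T b → T (if b then false else true)
T-if-not⁺ {true}  ¬b = ¬b tt
T-if-not⁺ {false} ¬b = tt

T-if-not⁻ : ∀ {b} → T (if b then false else true) → ¬ T b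
T-if-not⁻ {false} _ ()

T-anyB⁺ : ∀ {A : Set} {p : A → Bool} {x xs} → x ∈ xs → T (p x) → T (anyB p xs)
T-anyB⁺ (here refl) px = from T-∨ (inj₁ px)
T-anyB⁺ (there x∈)  px = from T-∨ (inj₂ (T-anyB⁺ x∈ px))

T-anyB⁻ : ∀ {A : Set} (p : A → Bool) xs → T (anyB p xs) → ∃ λ x → T (p x)
T-anyB⁻ p (x ∷ xs) t with to T-∨ t
... | inj₁ px = x , px
... | inj₂ t′ = T-anyB⁻ p xs t′

T-allB⁺ : ∀ {A : Set} {n} (p : A → Bool) (f : Fin n → A) → (∀ i → T (p (f i))) → T (allB p (tabulate f))
T-allB⁺ {n = zero}  p f h = tt
T-allB⁺ {n = suc n} p f h = h zero & T-allB⁺ p (f ∘ suc) (h ∘ suc)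

T-allB⁻ : ∀ {A : Set} {n} (p : A → Bool) (f : Fin n → A) → T (allB p (tabulate f)) → ∀ i → T (p (f i))
T-allB⁻ p f t zero    = proj₁ (to T-∧ t)
T-allB⁻ p f t (suc i) = T-allB⁻ p (f ∘ suc) (proj₂ (to (T-∧ {p (f zero)}) t)) i

isMatching⁺ : ∀ {N} (v : Vec (Fin N) N) → Matching v → T (isMatching v)
isMatching⁺ v m = T-allB⁺ _ id λ i →
  ≡⇒=ᶠ (lookup v (lookup v i)) i (proj₁ (m i)) & T-if-not⁺ (proj₂ (m i) ∘ =ᶠ⇒≡ (lookup v i) i)

isMatching⁻ : ∀ {N} (v : Vec (Fin N) N) → T (isMatching v) → Matching v
isMatching⁻ v t i =
  let inv , fpf = to (T-∧ {lookup v (lookup v i) =ᶠ i}) (T-allB⁻ _ id t i)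
  in =ᶠ⇒≡ _ _ inv , T-if-not⁻ fpf ∘ ≡⇒=ᶠ (lookup v i) i

increasing⁺ : ∀ {N} (a b c d e f : Fin N) → toℕ a < toℕ b → toℕ b < toℕ c → toℕ c < toℕ d →
  toℕ d < toℕ e → toℕ e < toℕ f → T (increasing (a ∷ b ∷ c ∷ d ∷ e ∷ f ∷ []))
increasing⁺ _ _ _ _ _ _ ab bc cd de ef = <⇒<ᵇ ab & <⇒<ᵇ bc & <⇒<ᵇ cd & <⇒<ᵇ de & <⇒<ᵇ ef & tt

increasing⁻ : ∀ {N} (a b c d e f : Fin N) → T (increasing (a ∷ b ∷ c ∷ d ∷ e ∷ f ∷ [])) →
  toℕ a < toℕ b × toℕ b < toℕ c × toℕ c < toℕ d × toℕ d < toℕ e × toℕ e < toℕ f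
increasing⁻ a b c d e f t =
  let ab , t₁ = to (T-∧ {a <ᶠ b}) t
      bc , t₂ = to (T-∧ {b <ᶠ c}) t₁
      cd , t₃ = to (T-∧ {c <ᶠ d}) t₂
      de , t₄ = to (T-∧ {d <ᶠ e}) t₃
      ef , _  = to (T-∧ {e <ᶠ f}) t₄
  in <ᶠ⇒< a b ab , <ᶠ⇒< b c bc , <ᶠ⇒< c d cd , <ᶠ⇒< d e de , <ᶠ⇒< e f ef

arcs⁻ : ∀ {N} (i j k l m n : Fin N) → T ((i =ᶠ j) ∧ (k =ᶠ l) ∧ (m =ᶠ n) ∧ true) → i ≡ j × k ≡ l × m ≡ n
arcs⁻ i j k l m n t =
  let ij , t₁ = to (T-∧ {i =ᶠ j}) t
      kl , t₂ = to (T-∧ {k =ᶠ l}) t₁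
      mn , _  = to (T-∧ {m =ᶠ n}) t₂
  in =ᶠ⇒≡ i j ij , =ᶠ⇒≡ k l kl , =ᶠ⇒≡ m n mn

arcs⁺ : ∀ {N} (i j k : Fin N) → T ((i =ᶠ i) ∧ (j =ᶠ j) ∧ (k =ᶠ k) ∧ true)
arcs⁺ i j k = ≡⇒=ᶠ i i refl & ≡⇒=ᶠ j j refl & ≡⇒=ᶠ k k refl & tt

∧⇒< : ∀ {N} (a b c d e f : Fin N) → T ((a <ᶠ b) ∧ (c <ᶠ d) ∧ (e <ᶠ f)) →
  toℕ a < toℕ b × toℕ c < toℕ d × toℕ e < toℕ f
∧⇒< a b c d e f t =
  let a<b , t₁  = to (T-∧ {a <ᶠ b}) t
      c<d , e<f = to (T-∧ {c <ᶠ d}) t₁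
  in <ᶠ⇒< a b a<b , <ᶠ⇒< c d c<d , <ᶠ⇒< e f e<f

-- Nestings and crossings as covering statistics.

nesting : Statistic
nesting = record
  { related       = λ a b a′ b′ → (a <ᶠ b) ∧ (b <ᶠ b′) ∧ (b′ <ᶠ a′)
  ; related-embed = λ f h a b a′ b′ → cong₂ _∧_ (h a b) (cong₂ _∧_ (h b b′) (h b′ a′))
  ; related⇒<     = λ {_} {a} {b} {a′} {b′} r → let a<b , b<b′ , b′<a′ = ∧⇒< a b b b′ b′ a′ r in a<b , <-trans b<b′ b′<a′ , b<b′
  -- The covering arcs close beyond `suc j`, at one of the points from `2 + j` to `suc M`.
  ; rank          = λ M t j → M ∸ j
  ; position      = λ M t e → M ∸ e
  ; rank≤         = λ {c} {t} t≤j _ → ≤-trans (∸-monoʳ-≤ (t + c) t≤j) (≤-reflexive (m+n∸m≡n t c))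
  ; position-≥    = λ {c} {t} e≤c → m+n≤o⇒m≤o∸n t (+-monoʳ-≤ t e≤c)
  ; position-≤    = λ {c} {t} {e} _ → m∸n≤m (t + c) e
  ; rank-position = λ {c} {t} e≤c → m∸[m∸n]≡n (m≤n⇒m≤o+n t e≤c)
  ; position-rank = λ _ j≤M → m∸[m∸n]≡n j≤M
  ; start         = λ M t j → 2 + j
  ; start-bound   = λ _ j≤M → ≤-reflexive (cong (2 +_) (m+[n∸m]≡n j≤M))
  ; window⁻       = λ {M} {j} {a} {b} {a′} {b′} _ j≤M b′≡ r →
                      subst (_< toℕ a′) b′≡ (proj₂ (proj₂ (∧⇒< a b b b′ b′ a′ r)))
                    , <-≤-trans (toℕ<n a′) (≤-reflexive (cong (2 +_) (sym (m+[n∸m]≡n j≤M))))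
  ; window⁺       = λ {M} {j} {a} {b} {a′} {b′} b≤j _ b′≡ opens lo _ →
                      let b<b′  = subst (toℕ b <_) (sym b′≡) (s≤s b≤j)
                          b′<a′ = subst (_< toℕ a′) (sym b′≡) lo
                      in <⇒<ᵇ (opens (<-trans b<b′ b′<a′) (λ e → <-irrefl (cong toℕ (sym e)) b′<a′))
                         & <⇒<ᵇ b<b′ & <⇒<ᵇ b′<a′
  }

crossing : Statistic
crossing = record
  { related       = λ a b a′ b′ → (a <ᶠ b) ∧ (b <ᶠ a′) ∧ (a′ <ᶠ b′)
  ; related-embed = λ f h a b a′ b′ → cong₂ _∧_ (h a b) (cong₂ _∧_ (h b a′) (h a′ b′))
  ; related⇒<     = λ {_} {a} {b} {a′} {b′} r → let a<b , b<a′ , a′<b′ = ∧⇒< a b b a′ a′ b′ r in a<b , b<a′ , <-trans b<a′ a′<b′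
  -- The covering arcs close strictly between the two ends, at one of the points from `suc t` to
  -- `j`.
  ; rank          = λ M t j → j ∸ t
  ; position      = λ M t e → t + e
  ; rank≤         = λ {c} {t} {j} _ j≤t+c → m≤n+o⇒m∸n≤o j t j≤t+c
  ; position-≥    = λ {c} {t} {e} _ → m≤m+n t e
  ; position-≤    = λ {c} {t} e≤c → +-monoʳ-≤ t e≤c
  ; rank-position = λ {c} {t} {e} _ → m+n∸m≡n t e
  ; position-rank = λ t≤j _ → m+[n∸m]≡n t≤j
  ; start         = λ M t j → suc t
  ; start-bound   = λ t≤j j≤M → s≤s (≤-trans (≤-reflexive (m+[n∸m]≡n t≤j)) (m≤n⇒m≤1+n j≤M))
  ; window⁻       = λ {M} {j} {a} {b} {a′} {b′} b≤j _ b′≡ r →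
                      let _ , b<a′ , a′<b′ = ∧⇒< a b b a′ a′ b′ r
                      in b<a′ , subst (toℕ a′ <_) (trans b′≡ (cong suc (sym (m+[n∸m]≡n b≤j)))) a′<b′
  ; window⁺       = λ {M} {j} {a} {b} {a′} {b′} b≤j _ b′≡ opens b<a′ hi →
                      let a′<b′ = subst (toℕ a′ <_) (trans (cong suc (m+[n∸m]≡n b≤j)) (sym b′≡)) hi
                      in <⇒<ᵇ (opens b<a′ (λ e → <-irrefl (cong toℕ e) a′<b′)) & <⇒<ᵇ b<a′ & <⇒<ᵇ a′<b′
  }

module Nest  = Counting nesting
module Cross = Counting crossing

-- Pattern avoidance as a bound on degrees.

module _ {N : ℕ} (v : Vec (Fin N) N) where

  -- Two arcs covering the arc of `b` form a pattern with it: 213 if they cross each other, 123 if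
  -- they are nested.
  nest-degree≤1⁺ : Matching v → ¬ T (containsPat p123 v) → ¬ T (containsPat p213 v) → ∀ b → Nest.degree v b ≤ 1
  nest-degree≤1⁺ m ¬123 ¬213 = Nest.degree≤1⁺ v m no-pair
    where
    no-pair : ∀ a a′ b → toℕ a < toℕ a′ → lookup v a ≢ lookup v a′ →
      T ((a <ᶠ b) ∧ (b <ᶠ lookup v b) ∧ (lookup v b <ᶠ lookup v a)) →
      ¬ T ((a′ <ᶠ b) ∧ (b <ᶠ lookup v b) ∧ (lookup v b <ᶠ lookup v a′))
    no-pair a a′ b a<a′ va≢va′ r r′
      with ∧⇒< a b b (lookup v b) (lookup v b) (lookup v a) r
         | ∧⇒< a′ b b (lookup v b) (lookup v b) (lookup v a′) r′
         | <-cmp (toℕ (lookup v a)) (toℕ (lookup v a′))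
    ... | _ , _ , vb<va | a′<b , b<vb , vb<va′ | tri< va<va′ _ _ = ¬213 (T-anyB⁺
      (∈-allVec (a ∷ a′ ∷ b ∷ lookup v b ∷ lookup v a ∷ lookup v a′ ∷ []))
      (increasing⁺ a a′ b (lookup v b) (lookup v a) (lookup v a′) a<a′ a′<b b<vb vb<va va<va′
        & arcs⁺ (lookup v a) (lookup v a′) (lookup v b)))
    ... | _ | _ | tri≈ _ va≡va′ _ = va≢va′ (toℕ-injective va≡va′)
    ... | _ , _ , vb<va | a′<b , b<vb , vb<va′ | tri> _ _ va′<va = ¬123 (T-anyB⁺
      (∈-allVec (a ∷ a′ ∷ b ∷ lookup v b ∷ lookup v a′ ∷ lookup v a ∷ []))
      (increasing⁺ a a′ b (lookup v b) (lookup v a′) (lookup v a) a<a′ a′<b b<vb vb<va′ va′<va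
        & arcs⁺ (lookup v a) (lookup v a′) (lookup v b)))

  -- In an occurrence the first two arcs both cover the third.
  nest-degree≤1⇒¬123 : (∀ b → Nest.degree v b ≤ 1) → ¬ T (containsPat p123 v)
  nest-degree≤1⇒¬123 d≤1 t with T-anyB⁻ _ (allVec 6 N) t
  ... | w@(a ∷ a′ ∷ b ∷ x ∷ y ∷ z ∷ []) , t′
    with to (T-∧ {increasing w}) t′
  ... | inc , arcs with increasing⁻ a a′ b x y z inc | arcs⁻ (lookup v a) z (lookup v a′) y (lookup v b) x arcs
  ... | a<a′ , a′<b , b<x , x<y , y<z | refl , refl , refl = Nest.degree≤1⁻ v d≤1 {a} {a′} {b} a<a′
    (<⇒<ᵇ (<-trans a<a′ a′<b) & <⇒<ᵇ b<x & <⇒<ᵇ (<-trans x<y y<z))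
    (<⇒<ᵇ a′<b & <⇒<ᵇ b<x & <⇒<ᵇ x<y)

  nest-degree≤1⇒¬213 : (∀ b → Nest.degree v b ≤ 1) → ¬ T (containsPat p213 v)
  nest-degree≤1⇒¬213 d≤1 t with T-anyB⁻ _ (allVec 6 N) t
  ... | w@(a ∷ a′ ∷ b ∷ x ∷ y ∷ z ∷ []) , t′
    with to (T-∧ {increasing w}) t′
  ... | inc , arcs with increasing⁻ a a′ b x y z inc | arcs⁻ (lookup v a) y (lookup v a′) z (lookup v b) x arcs
  ... | a<a′ , a′<b , b<x , x<y , y<z | refl , refl , refl = Nest.degree≤1⁻ v d≤1 {a} {a′} {b} a<a′
    (<⇒<ᵇ (<-trans a<a′ a′<b) & <⇒<ᵇ b<x & <⇒<ᵇ x<y)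
    (<⇒<ᵇ a′<b & <⇒<ᵇ b<x & <⇒<ᵇ (<-trans x<y y<z))

  -- Two arcs that cross the arc of `b` from the left form a pattern with it: 321 if they cross each
  -- other, 231 if they are nested.
  cross-degree≤1⁺ : Matching v → ¬ T (containsPat p231 v) → ¬ T (containsPat p321 v) → ∀ b → Cross.degree v b ≤ 1
  cross-degree≤1⁺ m ¬231 ¬321 = Cross.degree≤1⁺ v m no-pair
    where
    no-pair : ∀ a a′ b → toℕ a < toℕ a′ → lookup v a ≢ lookup v a′ →
      T ((a <ᶠ b) ∧ (b <ᶠ lookup v a) ∧ (lookup v a <ᶠ lookup v b)) →
      ¬ T ((a′ <ᶠ b) ∧ (b <ᶠ lookup v a′) ∧ (lookup v a′ <ᶠ lookup v b))
    no-pair a a′ b a<a′ va≢va′ r r′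
      with ∧⇒< a b b (lookup v a) (lookup v a) (lookup v b) r
         | ∧⇒< a′ b b (lookup v a′) (lookup v a′) (lookup v b) r′
         | <-cmp (toℕ (lookup v a)) (toℕ (lookup v a′))
    ... | _ , b<va , va<vb | a′<b , b<va′ , va′<vb | tri< va<va′ _ _ = ¬321 (T-anyB⁺
      (∈-allVec (a ∷ a′ ∷ b ∷ lookup v a ∷ lookup v a′ ∷ lookup v b ∷ []))
      (increasing⁺ a a′ b (lookup v a) (lookup v a′) (lookup v b) a<a′ a′<b b<va va<va′ va′<vb
        & arcs⁺ (lookup v a) (lookup v a′) (lookup v b)))
    ... | _ | _ | tri≈ _ va≡va′ _ = va≢va′ (toℕ-injective va≡va′)
    ... | _ , b<va , va<vb | a′<b , b<va′ , va′<vb | tri> _ _ va′<va = ¬231 (T-anyB⁺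
      (∈-allVec (a ∷ a′ ∷ b ∷ lookup v a′ ∷ lookup v a ∷ lookup v b ∷ []))
      (increasing⁺ a a′ b (lookup v a′) (lookup v a) (lookup v b) a<a′ a′<b b<va′ va′<va va<vb
        & arcs⁺ (lookup v a) (lookup v a′) (lookup v b)))

  cross-degree≤1⇒¬231 : (∀ b → Cross.degree v b ≤ 1) → ¬ T (containsPat p231 v)
  cross-degree≤1⇒¬231 d≤1 t with T-anyB⁻ _ (allVec 6 N) t
  ... | w@(a ∷ a′ ∷ b ∷ x ∷ y ∷ z ∷ []) , t′
    with to (T-∧ {increasing w}) t′
  ... | inc , arcs with increasing⁻ a a′ b x y z inc | arcs⁻ (lookup v a) y (lookup v a′) x (lookup v b) z arcs
  ... | a<a′ , a′<b , b<x , x<y , y<z | refl , refl , refl = Cross.degree≤1⁻ v d≤1 {a} {a′} {b} a<a′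
    (<⇒<ᵇ (<-trans a<a′ a′<b) & <⇒<ᵇ (<-trans b<x x<y) & <⇒<ᵇ y<z)
    (<⇒<ᵇ a′<b & <⇒<ᵇ b<x & <⇒<ᵇ (<-trans x<y y<z))

  cross-degree≤1⇒¬321 : (∀ b → Cross.degree v b ≤ 1) → ¬ T (containsPat p321 v)
  cross-degree≤1⇒¬321 d≤1 t with T-anyB⁻ _ (allVec 6 N) t
  ... | w@(a ∷ a′ ∷ b ∷ x ∷ y ∷ z ∷ []) , t′
    with to (T-∧ {increasing w}) t′
  ... | inc , arcs with increasing⁻ a a′ b x y z inc | arcs⁻ (lookup v a) x (lookup v a′) y (lookup v b) z arcs
  ... | a<a′ , a′<b , b<x , x<y , y<z | refl , refl , refl = Cross.degree≤1⁻ v d≤1 {a} {a′} {b} a<a′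
    (<⇒<ᵇ (<-trans a<a′ a′<b) & <⇒<ᵇ b<x & <⇒<ᵇ (<-trans x<y y<z))
    (<⇒<ᵇ a′<b & <⇒<ᵇ (<-trans b<x x<y) & <⇒<ᵇ y<z)

  nestings-degree : nestings v ≡ ∑ (Nest.degree v)
  nestings-degree = sum-countB λ a b → (a <ᶠ b) ∧ (b <ᶠ lookup v b) ∧ (lookup v b <ᶠ lookup v a)

  crossings-degree : crossings v ≡ ∑ (Cross.degree v)
  crossings-degree = sum-countB λ a b → (a <ᶠ b) ∧ (b <ᶠ lookup v a) ∧ (lookup v a <ᶠ lookup v b)

-- Counting the avoiding matchings.

module _ (S : Statistic) where
  open Counting S

  -- The reading starts with `t = N` at height 0, where the condition on closers is vacuous and
  -- `Good` amounts to the two avoidance conditions and the value `k` of the statistic.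
  countMatchings-paths : ∀ N k {r} (σ τ : Vec (Fin r) r) (stat : Vec (Fin N) N → ℕ) →
    (∀ v → stat v ≡ ∑ (degree v)) →
    (∀ v → Matching v → ¬ T (containsPat σ v) → ¬ T (containsPat τ v) → ∀ b → degree v b ≤ 1) →
    (∀ v → (∀ b → degree v b ≤ 1) → ¬ T (containsPat σ v)) →
    (∀ v → (∀ b → degree v b ≤ 1) → ¬ T (containsPat τ v)) →
    countMatchings N (λ v → avoids σ v ∧ avoids τ v ∧ (stat v ≡ᵇ k)) ≡ paths N 0 k
  countMatchings-paths N k σ τ stat stat≡ avoid⇒ ⇒avoidσ ⇒avoidτ =
    countB-allVec _ sound complete (card-good N 0 k (sym (+-identityʳ N)))
    where
    sound : ∀ {v} → T (isMatching v ∧ avoids σ v ∧ avoids τ v ∧ (stat v ≡ᵇ k)) → Good N k v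
    sound {v} t =
      let m  , t₁  = to (T-∧ {isMatching v}) t
          aσ , t₂  = to (T-∧ {avoids σ v}) t₁
          aτ , s≡k = to (T-∧ {avoids τ v}) t₂
          m′ = isMatching⁻ v m
      in good m′ (λ x N≤x → contradiction (toℕ<n x) (≤⇒≯ N≤x))
           (avoid⇒ v m′ (T-if-not⁻ aσ) (T-if-not⁻ aτ))
           (trans (sym (stat≡ v)) (≡ᵇ⇒≡ (stat v) k s≡k))

    complete : ∀ {v} → Good N k v → T (isMatching v ∧ avoids σ v ∧ avoids τ v ∧ (stat v ≡ᵇ k))
    complete {v} (good m _ d≤1 total) =
      isMatching⁺ v m & T-if-not⁺ (⇒avoidσ v d≤1) & T-if-not⁺ (⇒avoidτ v d≤1) & ≡⇒≡ᵇ (stat v) k (trans (stat≡ v) total)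

theorem5 : (n k : ℕ) → k ≤ n →
    (borelT n k ≡ countMatchings (2 * suc n)
    (λ v → avoids p123 v ∧ avoids p213 v ∧ (nestings v ≡ᵇ k)))
    × (borelT n k ≡ countMatchings (2 * suc n)
    (λ v → avoids p231 v ∧ avoids p321 v ∧ (crossings v ≡ᵇ k)))
theorem5 n k k≤n =
    trans (borelT-paths n k k≤n) (sym (countMatchings-paths nesting (2 * suc n) k p123 p213 nestings
      nestings-degree nest-degree≤1⁺ nest-degree≤1⇒¬123 nest-degree≤1⇒¬213))
  , trans (borelT-paths n k k≤n) (sym (countMatchings-paths crossing (2 * suc n) k p231 p321 crossings
      crossings-degree cross-degree≤1⁺ cross-degree≤1⇒¬231 cross-degree≤1⇒¬321))
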